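{- Let $P$ and $Q$ be rational $d$-dimensional polytopes in $\mathbb{R}^d$ such that the normal fan $\mathcal{N}(P)$ is a refinement of $\mathcal{N}(Q)$, and such that $\ell(e_P)\geq d\cdot\ell(e_Q)$ for every edge $e_P$ of $P$ whose image $e_Q=\Phi(e_P)$ is an edge of $Q$. Then the pair $(Q,P)$ is convex-normal, i.e. $Q+P=G(Q)+P$.
   Context: A rational polytope is the convex hull of finitely many points of $\mathbb{Q}^d$. For a polytope $Q$ with vertex set $\mathrm{ver}(Q)$ set $G(Q):=\bigcup_{v\in\mathrm{ver}(Q)}\big((v+\mathbb{Z}^d)\cap Q\big)$. A pair $(Q,P)$ is convex-normal if $Q+P=G(Q)+P$ (Minkowski sums). For a nonempty face $F$ of a polytope $P$, its normal cone is $C_F=\{c: \{z: c^tz=\max_{x\in P}c^tx\}\supseteq F\}$ (intersected with $P$); the normal fan $\mathcal{N}(P)$ is the collection of these cones, and $F\mapsto C_F$ is an inclusion-reversing bijection. $\mathcal{N}(P)$ refines $\mathcal{N}(Q)$ if every cone of $\mathcal{N}(P)$ is contained in some cone of $\mathcal{N}(Q)$. In that case, for a face $F$ of $P$, $\Phi(F)$ denotes the face $G$ of $Q$ whose normal cone $C_G$ is the smallest cone of $\mathcal{N}(Q)$ containing $C_F$. Lattice length: for an edge with edge vector $e=w-v$, let $u$ be the primitive integer vector on the line spanned by $w-v$; then $e=ku$ and $\ell(e):=|k|$.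
   Formalization: The polytopes, their faces and normal cones, and the equality Q+P = G(Q)+P are taken over points and linear functionals with rational coordinates, in place of all of R^d. -}

module Defs where

open import Data.Nat as ℕ using (ℕ; zero; suc)
open import Data.Nat.Divisibility using (_∣_)
open import Data.Integer as ℤ using (ℤ; +_)
open import Data.Rational using (ℚ; 0ℚ; 1ℚ; _+_; _*_; _-_; _≤_; _/_; ∣_∣)
open import Data.Fin using (Fin)
open import Data.Vec using (Vec; []; _∷_; zipWith; map; replicate; foldr; lookup)
open import Data.Vec.Relation.Unary.All using (All)
open import Data.Product using (Σ; ∃; _×_; _,_)
open import Function.Bundles using (_⇔_)
open import Relation.Binary.PropositionalEquality using (_≡_; _≢_)
open import Relation.Nullary using (¬_)

Point : ℕ → Set
Point d = Vec ℚ d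

Region : ℕ → Set₁
Region d = Point d → Set

ℤtoℚ : ℤ → ℚ
ℤtoℚ z = z / 1

ℕtoℚ : ℕ → ℚ
ℕtoℚ n = (+ n) / 1

sumℚ : ∀ {n} → Vec ℚ n → ℚ
sumℚ = foldr _ _+_ 0ℚ

_⊕_ : ∀ {d} → Point d → Point d → Point d
_⊕_ = zipWith _+_

_⊖_ : ∀ {d} → Point d → Point d → Point d
_⊖_ = zipWith _-_

_·_ : ∀ {d} → Point d → Point d → ℚ
c · x = sumℚ (zipWith _*_ c x)

scale : ∀ {d} → ℚ → Point d → Point d
scale k = map (k *_)

origin : ∀ {d} → Point d
origin = replicate _ 0ℚ

lincomb : ∀ {d n} → Vec ℚ n → Vec (Point d) n → Point d
lincomb [] [] = origin
lincomb (w ∷ ws) (v ∷ vs) = scale w v ⊕ lincomb ws vs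

Conv : ∀ {d n} → Vec (Point d) n → Region d
Conv {d} {n} V x =
  Σ (Vec ℚ n) λ w → All (0ℚ ≤_) w × sumℚ w ≡ 1ℚ × lincomb w V ≡ x

FullDim : ∀ {d} → Region d → Set
FullDim {d} P =
  (∃ λ x → P x) ×
  ¬ (Σ (Point d) λ c → c ≢ origin × (∀ x y → P x → P y → c · x ≡ c · y))

Maximizer : ∀ {d} → Region d → Point d → Region d
Maximizer P c x = P x × (∀ y → P y → c · y ≤ c · x)

IsFace : ∀ {d} → Region d → Region d → Set
IsFace {d} P F =
  (∃ λ x → F x) × Σ (Point d) λ c → (∀ x → F x ⇔ Maximizer P c x)

NormalCone : ∀ {d} → Region d → Region d → Region d
NormalCone P F c = ∀ x → F x → Maximizer P c x

_⊆_ : ∀ {d} → Region d → Region d → Set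
A ⊆ B = ∀ x → A x → B x

IsVertex : ∀ {d} → Region d → Point d → Set
IsVertex P v = IsFace P (λ x → x ≡ v)

IsEdge : ∀ {d} → Region d → Region d → Point d → Point d → Set
IsEdge P F v w = IsFace P F × v ≢ w × (∀ x → F x ⇔ Conv (v ∷ w ∷ []) x)

Refines : ∀ {d} → Region d → Region d → Set₁
Refines P Q = ∀ F → IsFace P F →
  ∃ λ G → IsFace Q G × (NormalCone P F ⊆ NormalCone Q G)

IsΦ : ∀ {d} → Region d → Region d → Region d → Region d → Set₁
IsΦ P Q F G =
  IsFace Q G × (NormalCone P F ⊆ NormalCone Q G) ×
  (∀ G' → IsFace Q G' → NormalCone P F ⊆ NormalCone Q G' →
     NormalCone Q G ⊆ NormalCone Q G')

-- Primitive integer vector: the only natural number dividing all its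
-- coordinates is 1 (this also forces u ≠ 0, since 0 ∣ 0).
Primitive : ∀ {d} → Vec ℤ d → Set
Primitive {d} u = ∀ (m : ℕ) → (∀ (i : Fin d) → m ∣ ℤ.∣ lookup u i ∣) → m ≡ 1

-- e = k·u with u primitive integral; then ℓ(e) = |k|.
LatticeMultiple : ∀ {d} → Point d → ℚ → Set
LatticeMultiple {d} e k =
  Σ (Vec ℤ d) λ u → Primitive u × e ≡ scale k (map ℤtoℚ u)

IsLatticePoint : ∀ {d} → Point d → Set
IsLatticePoint x = All (λ q → ∃ λ z → q ≡ ℤtoℚ z) x

GSet : ∀ {d} → Region d → Region d
GSet Q x = Q x × ∃ λ v → IsVertex Q v × IsLatticePoint (x ⊖ v)

MinkSum : ∀ {d} → Region d → Region d → Region d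
MinkSum A B x = ∃ λ a → ∃ λ b → A a × B b × x ≡ a ⊕ b

{-# OPTIONS --safe #-}
-- Every point of (d + 1)Q is a vertex of Q plus a point of dQ: by Carathéodory it is a nonnegative combination, of
-- total weight d + 1, of at most d + 1 vertices, so some weight is at least 1. It therefore suffices that dQ is a
-- Minkowski summand of P, say P = dQ + R, because then Q + P = (d + 1)Q + R ⊆ ver(Q) + dQ + R = ver(Q) + P.
--
-- For the summand (Shephard), let q(p) be the vertex of Q with C_p ⊆ C_q(p). Along an edge from p to p′ the
-- edge condition reads q(p′) - q(p) = t (p′ - p) with 0 ≤ d t ≤ 1, so a simplex step increasing c·p does not decrease
-- c·r(p), where r(p) = p - d q(p). Hence c·r is maximal at a c-maximal vertex, where it equals max c over P
-- minus d times max c over Q; by separation r(p) + dQ ⊆ P for every vertex p.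
module Submission where

open import Defs
open import Data.Nat as ℕ using (ℕ; zero; suc; s≤s; z≤n)
import Data.Nat.Properties as ℕ
open import Data.Nat.Divisibility using (_∣_; ∣1⇒≡1; ∣-trans)
open import Data.Nat.Coprimality as Coprimality using (coprime-divisor)
open import Data.Integer as ℤ using () renaming (+_ to int)
import Data.Integer.Properties as ℤ
open import Data.Rational.Unnormalised as ℚᵘ using (mkℚᵘ)
import Data.Rational.Unnormalised.Properties as ℚᵘ
open import Data.Rational
open import Data.Rational.Properties
open import Data.Fin using (Fin; zero; suc)
open import Data.Fin.Properties using (any?)
open import Data.Vec using (Vec; []; _∷_; lookup; tabulate; map; replicate; head; tail)
open import Data.Vec.Properties
  using (lookup-zipWith; lookup-map; lookup-replicate; tabulate∘lookup; lookup∘tabulate; tabulate-cong; ≡-dec; ∷-injectiveˡ)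
open import Data.Vec.Relation.Unary.All using (All; []; _∷_)
open import Data.Vec.Relation.Unary.All.Properties using (lookup⁺; lookup⁻)
open import Data.Product using (Σ; ∃; _×_; _,_; proj₁; proj₂)
open import Data.Sum using (_⊎_; inj₁; inj₂; [_,_]′)
open import Data.Empty using (⊥-elim)
open import Data.Unit using (⊤; tt)
open import Function using (_∘_; id; case_of_)
open import Function.Bundles using (_⇔_; mk⇔; module Equivalence)
open import Relation.Nullary using (¬_; Dec; yes; no; dec⇒maybe; contradiction)
open import Relation.Binary.Definitions using (tri<; tri≈; tri>)
open import Relation.Binary.PropositionalEquality
open import Tactic.RingSolver.Core.AlmostCommutativeRing using (AlmostCommutativeRing; fromCommutativeRing)
open import Tactic.RingSolver using (solve-∀)

-- A polytope is only a list of rational generators here, so vertices, edges and separating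
-- functionals all have to be produced. Separation comes from an elimination proof of Gordan's
-- alternative, and a vertex is a generator together with a functional exposing it. That functional
-- cuts out the vertex figure in which improving edges are found, and it also fixes the sign of t.
--
-- The difference q(p′) - q(p) is parallel to p′ - p for the following reason: any functional
-- orthogonal to p′ - p becomes normal to the edge once a large multiple of the functional
-- supporting the edge is added, and is then controlled at q(p) and q(p′).
--
-- The hypothesis on lengths speaks only of edges whose image is an edge, which is the case t > 0.
-- There a single primitive vector measures both edges, so t is the ratio of their lattice lengths.
-- For t = 0 the bound d t ≤ 1 is trivial.

private variable
  d n m : ℕ

ℚring : AlmostCommutativeRing _ _
ℚring = fromCommutativeRing +-*-commutativeRing λ x → dec⇒maybe (0ℚ ≟ x)

-- Ordered field arithmetic

<⇒0<- : ∀ {p q} → p < q → 0ℚ < q - p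
<⇒0<- {p} {q} p<q = subst (_< q - p) (+-inverseʳ p) (+-monoˡ-< (- p) p<q)

≤⇒0≤- : ∀ {p q} → p ≤ q → 0ℚ ≤ q - p
≤⇒0≤- {p} {q} p≤q = subst (_≤ q - p) (+-inverseʳ p) (+-monoˡ-≤ (- p) p≤q)

-+-cancel : ∀ p q → q - p + p ≡ q
-+-cancel = solve-∀ ℚring

0<-⇒< : ∀ {p q} → 0ℚ < q - p → p < q
0<-⇒< {p} {q} h = subst₂ _<_ (+-identityˡ p) (-+-cancel p q) (+-monoˡ-< p h)

0≤-⇒≤ : ∀ {p q} → 0ℚ ≤ q - p → p ≤ q
0≤-⇒≤ {p} {q} h = subst₂ _≤_ (+-identityˡ p) (-+-cancel p q) (+-monoˡ-≤ p h)

<-from : ∀ {p q r} → 0ℚ < r → r ≡ q - p → p < q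
<-from 0<r eq = 0<-⇒< (subst (0ℚ <_) eq 0<r)

≤-from : ∀ {p q r} → 0ℚ ≤ r → r ≡ q - p → p ≤ q
≤-from 0≤r eq = 0≤-⇒≤ (subst (0ℚ ≤_) eq 0≤r)

0<+ : ∀ {p q} → 0ℚ < p → 0ℚ ≤ q → 0ℚ < p + q
0<+ = +-mono-<-≤

0≤+ : ∀ {p q} → 0ℚ ≤ p → 0ℚ ≤ q → 0ℚ ≤ p + q
0≤+ = +-mono-≤

0<* : ∀ {p q} → 0ℚ < p → 0ℚ < q → 0ℚ < p * q
0<* {p} {q} 0<p 0<q = subst (_< p * q) (*-zeroʳ p) (*-monoʳ-<-pos p {{positive 0<p}} 0<q)

0≤* : ∀ {p q} → 0ℚ ≤ p → 0ℚ ≤ q → 0ℚ ≤ p * q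
0≤* {p} {q} 0≤p 0≤q = subst (_≤ p * q) (*-zeroʳ p) (*-monoˡ-≤-nonNeg p {{nonNegative 0≤p}} 0≤q)

0<*-cancelˡ : ∀ {p q} → 0ℚ ≤ p → 0ℚ < p * q → 0ℚ < q
0<*-cancelˡ {p} {q} 0≤p h = *-cancelˡ-<-nonNeg p {{nonNegative 0≤p}} (subst (_< p * q) (sym (*-zeroʳ p)) h)

0≤*-cancelˡ : ∀ {p q} → 0ℚ < p → 0ℚ ≤ p * q → 0ℚ ≤ q
0≤*-cancelˡ {p} {q} 0<p h = *-cancelˡ-≤-pos p {{positive 0<p}} (subst (_≤ p * q) (sym (*-zeroʳ p)) h)

<0⇒0<neg : ∀ {p} → p < 0ℚ → 0ℚ < - p
<0⇒0<neg = neg-antimono-<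

neg-square : ∀ p → (- p) * (- p) ≡ p * p
neg-square = solve-∀ ℚring

0≤sq : ∀ p → 0ℚ ≤ p * p
0≤sq p with ≤-total 0ℚ p
... | inj₁ 0≤p = 0≤* 0≤p 0≤p
... | inj₂ p≤0 = subst (0ℚ ≤_) (neg-square p) (0≤* (neg-antimono-≤ p≤0) (neg-antimono-≤ p≤0))

0<sq : ∀ {p} → p ≢ 0ℚ → 0ℚ < p * p
0<sq {p} p≢0 with <-cmp p 0ℚ
... | tri< p<0 _ _ = subst (0ℚ <_) (neg-square p) (0<* (<0⇒0<neg p<0) (<0⇒0<neg p<0))
... | tri≈ _ p≡0 _ = contradiction p≡0 p≢0
... | tri> _ _ 0<p = 0<* 0<p 0<p

0<1 : 0ℚ < 1ℚ
0<1 = positive⁻¹ 1ℚ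

0≤1 : 0ℚ ≤ 1ℚ
0≤1 = <⇒≤ 0<1

reciprocal : ∀ {p} → 0ℚ < p → ∃ λ ι → 0ℚ < ι × ι * p ≡ 1ℚ
reciprocal {p} 0<p =
  let instance
        pos : Positive p
        pos = positive 0<p
        nz : NonZero p
        nz = pos⇒nonZero p
        pos′ : Positive (1/ p)
        pos′ = 1/pos⇒pos p
  in 1/ p , positive⁻¹ (1/ p) , *-inverseˡ p

-- Finite extremal choices

dominate-one : ∀ f g → ∃ λ N → 0ℚ ≤ N × (f < 0ℚ → N * f + g < 0ℚ)
dominate-one f g with f <? 0ℚ
... | no f≮0 = 0ℚ , ≤-refl , λ f<0 → contradiction f<0 f≮0
... | yes f<0 with reciprocal (<0⇒0<neg f<0)
-- With `ι` = 1 / (- f), the product N f equals -(max(g, 0) + 1), so N f + g is at most -1. The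
-- maximum with 0 keeps N nonnegative.
... | ι , 0<ι , ι*-f≡1 = ι * (g ⊔ 0ℚ + 1ℚ) , 0≤* (<⇒≤ 0<ι) (0≤+ (p≤q⊔p g 0ℚ) 0≤1) , λ _ →
    subst (λ z → z + g < 0ℚ)
      (sym (trans (factor ι (g ⊔ 0ℚ) f) (cong (λ z → - (z * (g ⊔ 0ℚ + 1ℚ))) ι*-f≡1)))
      (<-from (0<+ 0<1 (≤⇒0≤- (p≤p⊔q g 0ℚ))) (difference g (g ⊔ 0ℚ)))
  where
  factor : ∀ ι s f → ι * (s + 1ℚ) * f ≡ - (ι * - f * (s + 1ℚ))
  factor = solve-∀ ℚring
  difference : ∀ g s → 1ℚ + (s - g) ≡ 0ℚ - (- (1ℚ * (s + 1ℚ)) + g)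
  difference = solve-∀ ℚring

-- The large-multiplier form of a small perturbation: N f + g is f tilted by g / N, up to scaling.
-- Individual multipliers may simply be added, because raising N only lowers N f where f is
-- negative.
dominate : (f g : Fin n → ℚ) → ∃ λ N → 0ℚ < N × (∀ i → f i < 0ℚ → N * f i + g i < 0ℚ)
dominate {zero} f g = 1ℚ , 0<1 , λ ()
dominate {suc n} f g
  with dominate-one (f zero) (g zero) | dominate (f ∘ suc) (g ∘ suc)
... | M , 0≤M , h | N , 0<N , hs = N + M , 0<+ 0<N 0≤M , λ where
    zero f₀<0 → <-from (0<+ (<⇒0<- (h f₀<0)) (0≤* (<⇒≤ 0<N) (<⇒≤ (<0⇒0<neg f₀<0))))
                  (increaseˡ N M (f zero) (g zero))
    (suc i) fᵢ<0 → <-from (0<+ (<⇒0<- (hs i fᵢ<0)) (0≤* 0≤M (<⇒≤ (<0⇒0<neg fᵢ<0))))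
                     (increaseʳ N M (f (suc i)) (g (suc i)))
  where
  increaseˡ : ∀ N M f g → 0ℚ - (M * f + g) + N * - f ≡ 0ℚ - ((N + M) * f + g)
  increaseˡ = solve-∀ ℚring
  increaseʳ : ∀ N M f g → 0ℚ - (N * f + g) + M * - f ≡ 0ℚ - ((N + M) * f + g)
  increaseʳ = solve-∀ ℚring

module _ {A : Set} {_≼_ : A → A → Set}
         (≼-total : ∀ a b → a ≼ b ⊎ b ≼ a) (≼-trans : ∀ {a b c} → a ≼ b → b ≼ c → a ≼ c) where

  private
    ≼-refl : ∀ a → a ≼ a
    ≼-refl a = [ id , id ]′ (≼-total a a)

  -- The order is a parameter because lexicographic pairs serve for extremal vertices and the
  -- reversed order of ℚ for a least ratio.
  argmax : {D : Fin n → Set} → (∀ i → Dec (D i)) → (f : Fin n → A) → ∃ D →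
           ∃ λ i → D i × (∀ j → D j → f j ≼ f i)
  argmax {n = suc n} {D} D? f nonempty with D? zero | any? (D? ∘ suc)
  ... | no ¬D₀ | no ¬Dₛ with nonempty
  ...   | zero  , D₀ = contradiction D₀ ¬D₀
  ...   | suc i , Dᵢ = contradiction (i , Dᵢ) ¬Dₛ
  argmax {D = D} D? f _ | yes D₀ | no ¬Dₛ = zero , D₀ , λ where
    zero    _  → ≼-refl (f zero)
    (suc j) Dⱼ → contradiction (j , Dⱼ) ¬Dₛ
  argmax {D = D} D? f _ | D₀? | yes Dₛ with argmax (D? ∘ suc) (f ∘ suc) Dₛ | D₀?
  ... | i , Dᵢ , h | no ¬D₀ = suc i , Dᵢ , λ where
    zero    D₀ → contradiction D₀ ¬D₀
    (suc j) Dⱼ → h j Dⱼ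
  ... | i , Dᵢ , h | yes D₀ with ≼-total (f zero) (f (suc i))
  ...   | inj₁ f₀≼fᵢ = suc i , Dᵢ , λ where
    zero    _  → f₀≼fᵢ
    (suc j) Dⱼ → h j Dⱼ
  ...   | inj₂ fᵢ≼f₀ = zero , D₀ , λ where
    zero    _  → ≼-refl (f zero)
    (suc j) Dⱼ → ≼-trans (h j Dⱼ) fᵢ≼f₀

infix 4 _≤ₗₑₓ_
_≤ₗₑₓ_ : ℚ × ℚ → ℚ × ℚ → Set
(a , b) ≤ₗₑₓ (a′ , b′) = a < a′ ⊎ (a ≡ a′ × b ≤ b′)

≤ₗₑₓ-total : ∀ p q → p ≤ₗₑₓ q ⊎ q ≤ₗₑₓ p
≤ₗₑₓ-total (a , b) (a′ , b′) with <-cmp a a′ | ≤-total b b′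
... | tri< a<a′ _ _ | _          = inj₁ (inj₁ a<a′)
... | tri> _ _ a′<a | _          = inj₂ (inj₁ a′<a)
... | tri≈ _ refl _ | inj₁ b≤b′ = inj₁ (inj₂ (refl , b≤b′))
... | tri≈ _ refl _ | inj₂ b′≤b = inj₂ (inj₂ (refl , b′≤b))

≤ₗₑₓ-trans : ∀ {p q r} → p ≤ₗₑₓ q → q ≤ₗₑₓ r → p ≤ₗₑₓ r
≤ₗₑₓ-trans (inj₁ a<b)         (inj₁ b<c)         = inj₁ (<-trans a<b b<c)
≤ₗₑₓ-trans (inj₁ a<b)         (inj₂ (refl , _))  = inj₁ a<b
≤ₗₑₓ-trans (inj₂ (refl , _))  (inj₁ b<c)         = inj₁ b<c
≤ₗₑₓ-trans (inj₂ (refl , p)) (inj₂ (refl , q)) = inj₂ (refl , ≤-trans p q)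

≤ₗₑₓ⇒≤ : ∀ {p q} → p ≤ₗₑₓ q → proj₁ p ≤ proj₁ q
≤ₗₑₓ⇒≤ (inj₁ a<a′)       = <⇒≤ a<a′
≤ₗₑₓ⇒≤ (inj₂ (refl , _)) = ≤-refl

-- Vectors and linear forms

lookup-extensionality : {A : Set} {x y : Vec A n} → (∀ i → lookup x i ≡ lookup y i) → x ≡ y
lookup-extensionality {x = x} {y} h =
  trans (sym (tabulate∘lookup x)) (trans (tabulate-cong h) (tabulate∘lookup y))

-- Syntax of vector expressions: a linear form (a coordinate, or c ·_) turns an identity between them into one in ℚ,
-- which the ring solver can prove.
infixl 6 _⊞_ _⊟_
infixr 7 _⊡_
data Expr (d : ℕ) : Set where
  ⟨_⟩     : Point d → Expr d
  𝟎       : Expr d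
  _⊞_ _⊟_ : Expr d → Expr d → Expr d
  _⊡_     : ℚ → Expr d → Expr d

⟦_⟧ : Expr d → Point d
⟦ ⟨ x ⟩ ⟧  = x
⟦ 𝟎 ⟧      = origin
⟦ e ⊞ f ⟧  = ⟦ e ⟧ ⊕ ⟦ f ⟧
⟦ e ⊟ f ⟧  = ⟦ e ⟧ ⊖ ⟦ f ⟧
⟦ k ⊡ e ⟧  = scale k ⟦ e ⟧

value : (Point d → ℚ) → Expr d → ℚ
value φ ⟨ x ⟩   = φ x
value φ 𝟎       = 0ℚ
value φ (e ⊞ f) = value φ e + value φ f
value φ (e ⊟ f) = value φ e - value φ f
value φ (k ⊡ e) = k * value φ e

record Linear (φ : Point d → ℚ) : Set where
  field
    origin-homo : φ origin ≡ 0ℚ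
    ⊕-homo      : ∀ x y → φ (x ⊕ y) ≡ φ x + φ y
    ⊖-homo      : ∀ x y → φ (x ⊖ y) ≡ φ x - φ y
    scale-homo  : ∀ k x → φ (scale k x) ≡ k * φ x

  value-homo : ∀ e → φ ⟦ e ⟧ ≡ value φ e
  value-homo ⟨ x ⟩   = refl
  value-homo 𝟎       = origin-homo
  value-homo (e ⊞ f) = trans (⊕-homo ⟦ e ⟧ ⟦ f ⟧) (cong₂ _+_ (value-homo e) (value-homo f))
  value-homo (e ⊟ f) = trans (⊖-homo ⟦ e ⟧ ⟦ f ⟧) (cong₂ _-_ (value-homo e) (value-homo f))
  value-homo (k ⊡ e) = trans (scale-homo k ⟦ e ⟧) (cong (k *_) (value-homo e))

lookup-linear : (i : Fin d) → Linear (λ x → lookup x i)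
lookup-linear i = record
  { origin-homo = lookup-replicate i 0ℚ
  ; ⊕-homo      = lookup-zipWith _+_ i
  ; ⊖-homo      = lookup-zipWith _-_ i
  ; scale-homo  = λ k x → lookup-map i (k *_) x
  }

point-≡ : (e f : Expr d) →
          (∀ i → value (λ x → lookup x i) e ≡ value (λ x → lookup x i) f) → ⟦ e ⟧ ≡ ⟦ f ⟧
point-≡ e f h = lookup-extensionality λ i →
  trans (Linear.value-homo (lookup-linear i) e)
    (trans (h i) (sym (Linear.value-homo (lookup-linear i) f)))

·-linear : (c : Point d) → Linear (c ·_)
·-linear c = record
  { origin-homo = ·-origin c
  ; ⊕-homo      = ·-⊕ c
  ; ⊖-homo      = ·-⊖ c
  ; scale-homo  = λ k → ·-scale k c
  }
  where
  rearrange+ : ∀ a b b′ s t → a * (b + b′) + (s + t) ≡ a * b + s + (a * b′ + t)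
  rearrange+ = solve-∀ ℚring
  rearrange- : ∀ a b b′ s t → a * (b - b′) + (s - t) ≡ a * b + s - (a * b′ + t)
  rearrange- = solve-∀ ℚring
  rearrange* : ∀ k a b s → a * (k * b) + k * s ≡ k * (a * b + s)
  rearrange* = solve-∀ ℚring

  ·-origin : (c : Point n) → c · origin ≡ 0ℚ
  ·-origin []      = refl
  ·-origin (a ∷ c) = trans (cong₂ _+_ (*-zeroʳ a) (·-origin c)) (+-identityˡ 0ℚ)

  ·-⊕ : (c x y : Point n) → c · (x ⊕ y) ≡ c · x + c · y
  ·-⊕ [] [] []                = refl
  ·-⊕ (a ∷ c) (b ∷ x) (b′ ∷ y) =
    trans (cong (a * (b + b′) +_) (·-⊕ c x y)) (rearrange+ a b b′ (c · x) (c · y))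

  ·-⊖ : (c x y : Point n) → c · (x ⊖ y) ≡ c · x - c · y
  ·-⊖ [] [] []                = refl
  ·-⊖ (a ∷ c) (b ∷ x) (b′ ∷ y) =
    trans (cong (a * (b - b′) +_) (·-⊖ c x y)) (rearrange- a b b′ (c · x) (c · y))

  ·-scale : ∀ k (c x : Point n) → c · scale k x ≡ k * (c · x)
  ·-scale k [] []           = sym (*-zeroʳ k)
  ·-scale k (a ∷ c) (b ∷ x) =
    trans (cong (a * (k * b) +_) (·-scale k c x)) (rearrange* k a b (c · x))

·-comm : (c x : Point d) → c · x ≡ x · c
·-comm [] []           = refl
·-comm (a ∷ c) (b ∷ x) = cong₂ _+_ (*-comm a b) (·-comm c x)

·-value : (c : Point d) (e : Expr d) → c · ⟦ e ⟧ ≡ value (c ·_) e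
·-value c = Linear.value-homo (·-linear c)

·-valueˡ : (e : Expr d) (x : Point d) → ⟦ e ⟧ · x ≡ value (_· x) e
·-valueˡ e x = Linear.value-homo record
  { origin-homo = trans (·-comm origin x) origin-homo
  ; ⊕-homo      = λ y z → trans (·-comm (y ⊕ z) x) (trans (⊕-homo y z) (cong₂ _+_ (·-comm x y) (·-comm x z)))
  ; ⊖-homo      = λ y z → trans (·-comm (y ⊖ z) x) (trans (⊖-homo y z) (cong₂ _-_ (·-comm x y) (·-comm x z)))
  ; scale-homo  = λ k y → trans (·-comm (scale k y) x) (trans (scale-homo k y) (cong (k *_) (·-comm x y)))
  } e
  where open Linear (·-linear x)

0≤x·x : (x : Point d) → 0ℚ ≤ x · x
0≤x·x []      = ≤-refl
0≤x·x (a ∷ x) = 0≤+ (0≤sq a) (0≤x·x x)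

x≢0⇒0<x·x : {x : Point d} → x ≢ origin → 0ℚ < x · x
x≢0⇒0<x·x {x = []} x≢0 = contradiction refl x≢0
x≢0⇒0<x·x {x = a ∷ x} x≢0 with a ≟ 0ℚ
... | no a≢0 = 0<+ (0<sq a≢0) (0≤x·x x)
... | yes refl = +-mono-≤-< (0≤sq 0ℚ) (x≢0⇒0<x·x λ x≡0 → x≢0 (cong (0ℚ ∷_) x≡0))

x·x≡0⇒x≡0 : {x : Point d} → x · x ≡ 0ℚ → x ≡ origin
x·x≡0⇒x≡0 {x = []} _ = refl
x·x≡0⇒x≡0 {x = a ∷ x} eq with a ≟ 0ℚ
... | no a≢0 = contradiction (sym eq) (<⇒≢ (0<+ (0<sq a≢0) (0≤x·x x)))
... | yes refl = cong (0ℚ ∷_) (x·x≡0⇒x≡0 (trans (sym (+-identityˡ _)) eq))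

≤∧≮⇒≡ : ∀ {p q} → p ≤ q → ¬ (p < q) → p ≡ q
≤∧≮⇒≡ p≤q p≮q = ≤-antisym p≤q (≮⇒≥ p≮q)

scale-0 : (x : Point d) → scale 0ℚ x ≡ origin
scale-0 x = point-≡ (0ℚ ⊡ ⟨ x ⟩) 𝟎 λ i → *-zeroˡ (lookup x i)

scale-1 : (x : Point d) → scale 1ℚ x ≡ x
scale-1 x = point-≡ (1ℚ ⊡ ⟨ x ⟩) ⟨ x ⟩ λ i → *-identityˡ (lookup x i)

scale-origin : ∀ k → scale k origin ≡ origin {d}
scale-origin {d} k = point-≡ (k ⊡ 𝟎 {d}) 𝟎 λ i → *-zeroʳ k

⊕-identityʳ : (x : Point d) → x ⊕ origin ≡ x
⊕-identityʳ x = point-≡ (⟨ x ⟩ ⊞ 𝟎) ⟨ x ⟩ λ i → +-identityʳ (lookup x i)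

⊕-identityˡ : (x : Point d) → origin ⊕ x ≡ x
⊕-identityˡ x = point-≡ (𝟎 ⊞ ⟨ x ⟩) ⟨ x ⟩ λ i → +-identityˡ (lookup x i)

⊖≡origin⇒≡ : {x y : Point d} → x ⊖ y ≡ origin → x ≡ y
⊖≡origin⇒≡ {x = x} {y} eq =
  trans (point-≡ ⟨ x ⟩ ((⟨ x ⟩ ⊟ ⟨ y ⟩) ⊞ ⟨ y ⟩) (λ i → sym (-+-cancel (lookup y i) (lookup x i))))
    (trans (cong (_⊕ y) eq) (⊕-identityˡ y))

_≟ₚ_ : (x y : Point d) → Dec (x ≡ y)
_≟ₚ_ = ≡-dec _≟_

-- Nonnegative combinations of prescribed total weight

-- `Conv V` is the case of weight 1. A free weight homogenises the polytope: the pairs (t, x) form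
-- the cone generated by the pairs (1, v), closed under sums and nonnegative multiples.
Comb : Vec (Point d) n → ℚ → Point d → Set
Comb {n = n} V t x = Σ (Vec ℚ n) λ w → All (0ℚ ≤_) w × sumℚ w ≡ t × lincomb w V ≡ x

comb-∷ : ∀ {V : Vec (Point d) n} {v k t x} → 0ℚ ≤ k → Comb V t x → Comb (v ∷ V) (k + t) (scale k v ⊕ x)
comb-∷ {k = k} 0≤k (w , 0≤w , refl , refl) = k ∷ w , 0≤k ∷ 0≤w , refl , refl

comb-there : ∀ {V : Vec (Point d) n} {v t x} → Comb V t x → Comb (v ∷ V) t x
comb-there {V = V} {v} {t} {x} h =
  subst₂ (Comb (v ∷ V)) (+-identityˡ t) (trans (cong (_⊕ x) (scale-0 v)) (⊕-identityˡ x)) (comb-∷ ≤-refl h)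

comb-0 : (V : Vec (Point d) n) → Comb V 0ℚ origin
comb-0 []      = [] , [] , refl , refl
comb-0 (v ∷ V) = comb-there (comb-0 V)

comb-+ : ∀ {V : Vec (Point d) n} {s t x y} → Comb V s x → Comb V t y → Comb V (s + t) (x ⊕ y)
comb-+ {V = []} ([] , [] , refl , refl) ([] , [] , refl , refl) = [] , [] , refl , sym (⊕-identityˡ origin)
comb-+ {V = v ∷ V} (k ∷ w , 0≤k ∷ 0≤w , refl , refl) (l ∷ w′ , 0≤l ∷ 0≤w′ , refl , refl) =
  subst₂ (Comb (v ∷ V)) (interchange k l (sumℚ w) (sumℚ w′))
    (point-≡ (((k + l) ⊡ ⟨ v ⟩) ⊞ (⟨ lincomb w V ⟩ ⊞ ⟨ lincomb w′ V ⟩))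
             (k ⊡ ⟨ v ⟩ ⊞ ⟨ lincomb w V ⟩ ⊞ (l ⊡ ⟨ v ⟩ ⊞ ⟨ lincomb w′ V ⟩))
             λ i → distribute k l (lookup v i) (lookup (lincomb w V) i) (lookup (lincomb w′ V) i))
    (comb-∷ (0≤+ 0≤k 0≤l) (comb-+ (w , 0≤w , refl , refl) (w′ , 0≤w′ , refl , refl)))
  where
  interchange : ∀ k l s t → k + l + (s + t) ≡ k + s + (l + t)
  interchange = solve-∀ ℚring
  distribute : ∀ k l v x y → (k + l) * v + (x + y) ≡ k * v + x + (l * v + y)
  distribute = solve-∀ ℚring

-- The induction principle of that cone: a relation stable under the cone operations need only be
-- checked on generators. `R` may also carry witnesses, so maps between cones are built in the same
-- way.
comb-elim : ∀ {V : Vec (Point d) n} (R : ℚ → Point d → Set) →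
  R 0ℚ origin →
  (∀ {s t x y} → R s x → R t y → R (s + t) (x ⊕ y)) →
  (∀ {t x} k → 0ℚ ≤ k → R t x → R (k * t) (scale k x)) →
  (∀ i → R 1ℚ (lookup V i)) →
  ∀ {t x} → Comb V t x → R t x
comb-elim {V = []} R R-0 R-+ R-* R-gen ([] , [] , refl , refl) = R-0
comb-elim {V = v ∷ V} R R-0 R-+ R-* R-gen (k ∷ w , 0≤k ∷ 0≤w , refl , refl) =
  R-+ (subst (λ t → R t (scale k v)) (*-identityʳ k) (R-* k 0≤k (R-gen zero)))
      (comb-elim R R-0 R-+ R-* (R-gen ∘ suc) (w , 0≤w , refl , refl))

comb-* : ∀ {V : Vec (Point d) n} {t x} k → 0ℚ ≤ k → Comb V t x → Comb V (k * t) (scale k x)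
comb-* {V = []} k _ ([] , [] , refl , refl) = [] , [] , sym (*-zeroʳ k) , sym (scale-origin k)
comb-* {V = v ∷ V} k 0≤k (l ∷ w , 0≤l ∷ 0≤w , refl , refl) =
  subst₂ (Comb (v ∷ V)) (sym (*-distribˡ-+ k l (sumℚ w)))
    (point-≡ ((k * l) ⊡ ⟨ v ⟩ ⊞ k ⊡ ⟨ lincomb w V ⟩) (k ⊡ (l ⊡ ⟨ v ⟩ ⊞ ⟨ lincomb w V ⟩))
             λ i → distribute k l (lookup v i) (lookup (lincomb w V) i))
    (comb-∷ (0≤* 0≤k 0≤l) (comb-* k 0≤k (w , 0≤w , refl , refl)))
  where
  distribute : ∀ k l v x → k * l * v + k * x ≡ k * (l * v + x)
  distribute = solve-∀ ℚring

comb-lookup : (V : Vec (Point d) n) (i : Fin n) → Comb V 1ℚ (lookup V i)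
comb-lookup (v ∷ V) zero =
  subst₂ (Comb (v ∷ V)) (+-identityʳ 1ℚ) (trans (⊕-identityʳ (scale 1ℚ v)) (scale-1 v)) (comb-∷ 0≤1 (comb-0 V))
comb-lookup (v ∷ V) (suc i) = comb-there (comb-lookup V i)

comb-bind : ∀ {V : Vec (Point d) n} {U : Vec (Point d) m} → (∀ i → Comb U 1ℚ (lookup V i)) →
            ∀ {t x} → Comb V t x → Comb U t x
comb-bind {U = U} = comb-elim (Comb U) (comb-0 U) comb-+ comb-*

comb-singleton : ∀ {v x : Point d} → Comb (v ∷ []) 1ℚ x → x ≡ v
comb-singleton {v = v} (k ∷ [] , _ , k+0≡1 , refl) =
  trans (⊕-identityʳ (scale k v)) (trans (cong (λ k → scale k v) (trans (sym (+-identityʳ k)) k+0≡1)) (scale-1 v))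

comb-pair : ∀ {v w : Point d} k l → 0ℚ ≤ k → 0ℚ ≤ l → k + l ≡ 1ℚ → Comb (v ∷ w ∷ []) 1ℚ (scale k v ⊕ scale l w)
comb-pair {v = v} {w} k l 0≤k 0≤l k+l≡1 =
  subst₂ (Comb (v ∷ w ∷ [])) (trans (cong (k +_) (+-identityʳ l)) k+l≡1)
    (cong (scale k v ⊕_) (⊕-identityʳ (scale l w)))
    (comb-∷ 0≤k (comb-∷ 0≤l (comb-0 [])))

conv-nonempty : ∀ {V : Vec (Point d) n} {x} → Conv V x → Fin n
conv-nonempty {V = []} ([] , [] , () , _)
conv-nonempty {V = v ∷ V} _ = zero

comb-≤ : ∀ {V : Vec (Point d) n} c M → (∀ i → c · lookup V i ≤ M) → ∀ {t x} → Comb V t x → c · x ≤ t * M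
comb-≤ {V = V} c M h = comb-elim (λ t x → c · x ≤ t * M)
  (≤-reflexive (trans (·-value c 𝟎) (sym (*-zeroˡ M))))
  (λ {s} {t} {x} {y} p q → subst₂ _≤_ (sym (·-value c (⟨ x ⟩ ⊞ ⟨ y ⟩))) (sym (*-distribʳ-+ M s t)) (+-mono-≤ p q))
  (λ {t} {x} k 0≤k p → subst₂ _≤_ (sym (·-value c (k ⊡ ⟨ x ⟩))) (sym (*-assoc k t M))
     (*-monoˡ-≤-nonNeg k {{nonNegative 0≤k}} p))
  (λ i → subst (c · lookup V i ≤_) (sym (*-identityˡ M)) (h i))

conv-≤ : ∀ {V : Vec (Point d) n} c {M} → (∀ i → c · lookup V i ≤ M) → ∀ {x} → Conv V x → c · x ≤ M
conv-≤ c {M} h {x} v = subst (c · x ≤_) (*-identityˡ M) (comb-≤ c M h v)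

-- Equality in a sum of inequalities forces equality in each summand. The bound and the conclusion
-- for equality therefore have to pass through the induction together.
comb-face : ∀ {V : Vec (Point d) n} {U : Vec (Point d) m} c M →
  (∀ i → (c · lookup V i ≡ M × Comb U 1ℚ (lookup V i)) ⊎ c · lookup V i < M) →
  ∀ {t x} → Comb V t x → c · x ≤ t * M × (c · x ≡ t * M → Comb U t x)
comb-face {V = V} {U} c M h = comb-elim (λ t x → c · x ≤ t * M × (c · x ≡ t * M → Comb U t x))
  (≤-reflexive (trans (·-value c 𝟎) (sym (*-zeroˡ M))) , λ _ → comb-0 U)
  (λ {s} {t} {x} {y} (p , f) (q , g) →
     subst₂ _≤_ (sym (·-value c (⟨ x ⟩ ⊞ ⟨ y ⟩))) (sym (*-distribʳ-+ M s t)) (+-mono-≤ p q) ,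
     λ eq → let eq′ = trans (sym (·-value c (⟨ x ⟩ ⊞ ⟨ y ⟩))) (trans eq (*-distribʳ-+ M s t)) in
       comb-+ (f (≤∧≮⇒≡ p (λ p< → <⇒≢ (+-mono-<-≤ p< q) eq′)))
              (g (≤∧≮⇒≡ q (λ q< → <⇒≢ (+-mono-≤-< p q<) eq′))))
  (λ {t} {x} k 0≤k (p , f) →
     subst₂ _≤_ (sym (·-value c (k ⊡ ⟨ x ⟩))) (sym (*-assoc k t M)) (*-monoˡ-≤-nonNeg k {{nonNegative 0≤k}} p) ,
     λ eq → let eq′ = trans (sym (·-value c (k ⊡ ⟨ x ⟩))) (trans eq (*-assoc k t M)) in
       case k ≟ 0ℚ of λ where
         -- With factor 0, equality says nothing about x, but the scaled point is the origin with
         -- weight 0.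
         (yes refl) → subst₂ (Comb U) (sym (*-zeroˡ t)) (sym (scale-0 x)) (comb-0 U)
         (no k≢0) → comb-* k 0≤k (f (≤∧≮⇒≡ p λ p< →
           <⇒≢ (*-monoʳ-<-pos k {{positive (≤∧≢⇒< 0≤k (k≢0 ∘ sym))}} p<) eq′)))
  gen
  where
  ≤∧≢⇒< : ∀ {p q} → p ≤ q → p ≢ q → p < q
  ≤∧≢⇒< p≤q p≢q = ≰⇒> λ q≤p → p≢q (≤-antisym p≤q q≤p)
  gen : ∀ i → c · lookup V i ≤ 1ℚ * M × (c · lookup V i ≡ 1ℚ * M → Comb U 1ℚ (lookup V i))
  gen i with h i
  ... | inj₁ (eq , u) = ≤-reflexive (trans eq (sym (*-identityˡ M))) , λ _ → u
  ... | inj₂ c<M = subst (c · lookup V i ≤_) (sym (*-identityˡ M)) (<⇒≤ c<M) ,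
                   λ eq → contradiction (trans eq (*-identityˡ M)) (<⇒≢ c<M)

conv-face : ∀ {V : Vec (Point d) n} {U : Vec (Point d) m} c {M} →
  (∀ i → (c · lookup V i ≡ M × Comb U 1ℚ (lookup V i)) ⊎ c · lookup V i < M) →
  ∀ {x} → Conv V x → c · x ≡ M → Conv U x
conv-face c {M} h v eq = proj₂ (comb-face c M h v) (trans eq (sym (*-identityˡ M)))

-- Gordan's alternative

-- The functional N c - v takes the value -|v|² at v, and for large N it stays negative on V, where
-- c is.
tilt : ∀ (V : Vec (Point d) n) c v → (∀ i → c · lookup V i < 0ℚ) → c · v ≡ 0ℚ → v ≢ origin →
       ∃ λ c′ → ∀ i → c′ · lookup (v ∷ V) i < 0ℚ
tilt V c v h c·v≡0 v≢0 with dominate (λ i → c · lookup V i) (λ i → - (v · lookup V i))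
... | N , 0<N , dom = scale N c ⊖ v , λ where
    zero → <-from (x≢0⇒0<x·x v≢0)
             (trans (lemma N (v · v))
                (cong (λ z → 0ℚ - z) (trans (cong (λ z → N * z - v · v) (sym c·v≡0)) (sym (·-valueˡ (N ⊡ ⟨ c ⟩ ⊟ ⟨ v ⟩) v)))))
    (suc i) → subst (_< 0ℚ) (sym (·-valueˡ (N ⊡ ⟨ c ⟩ ⊟ ⟨ v ⟩) (lookup V i))) (dom i (h i))
  where
  lemma : ∀ N s → s ≡ 0ℚ - (N * 0ℚ - s)
  lemma = solve-∀ ℚring

-- Induction on the list. If the functional c found for V is positive at the new vector v, the
-- vectors of V are projected along v into the hyperplane where c vanishes, and the induction
-- hypothesis is applied to the projections. As c is negative on V, each projection is a nonnegative
-- combination of its vector and v.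
gordan : (V : Vec (Point d) n) → Comb V 1ℚ origin ⊎ ∃ λ c → ∀ i → c · lookup V i < 0ℚ
gordan [] = inj₂ (origin , λ ())
gordan (v ∷ V) with gordan V
... | inj₁ h = inj₁ (comb-there h)
... | inj₂ (c , h) with <-cmp (c · v) 0ℚ
...   | tri< c·v<0 _ _ = inj₂ (c , λ where
          zero    → c·v<0
          (suc i) → h i)
...   | tri≈ _ c·v≡0 _ with v ≟ₚ origin
...     | yes refl = inj₁ (comb-lookup (v ∷ V) zero)
...     | no v≢0 = inj₂ (tilt V c v h c·v≡0 v≢0)
gordan (v ∷ V) | inj₂ (c , h) | tri> _ _ 0<c·v = answer (gordan (map project V))
  where
  v≢0 : v ≢ origin
  v≢0 refl = <⇒≢ 0<c·v (sym (·-value c 𝟎))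

  project : Point _ → Point _
  project u = scale (c · v) u ⊖ scale (c · u) v

  -- A projected generator has weight c·v - c·u in terms of `v ∷ V`, which varies with u. The lower
  -- bound by t (c·v) is what survives addition, and at t = 1 it makes the weight positive, so that
  -- it can be normalised to 1.
  ProjectedComb : ℚ → Point _ → Set
  ProjectedComb t x = ∃ λ s → t * (c · v) ≤ s × Comb (v ∷ V) s x

  projected : ∀ {t x} → Comb (map project V) t x → ProjectedComb t x
  projected = comb-elim ProjectedComb
    (0ℚ , ≤-reflexive (*-zeroˡ (c · v)) , comb-0 (v ∷ V))
    (λ {t} {t′} (s , t≤s , p) (s′ , t′≤s′ , p′) →
       s + s′ , subst (_≤ s + s′) (sym (*-distribʳ-+ (c · v) t t′)) (+-mono-≤ t≤s t′≤s′) , comb-+ p p′)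
    (λ {t} k 0≤k (s , t≤s , p) →
       k * s , subst (_≤ k * s) (sym (*-assoc k t (c · v))) (*-monoˡ-≤-nonNeg k {{nonNegative 0≤k}} t≤s) ,
       comb-* k 0≤k p)
    λ i → let u = lookup V i ; 0≤-c·u = <⇒≤ (<0⇒0<neg (h i)) in
      c · v + - (c · u) , ≤-from 0≤-c·u (weight (c · v) (c · u)) ,
      subst₂ (Comb (v ∷ V)) (cong₂ _+_ (*-identityʳ (c · v)) (*-identityʳ (- (c · u))))
        (trans (point-≡ ((c · v) ⊡ ⟨ u ⟩ ⊞ (- (c · u)) ⊡ ⟨ v ⟩) ((c · v) ⊡ ⟨ u ⟩ ⊟ (c · u) ⊡ ⟨ v ⟩)
                  λ j → point (c · v) (lookup u j) (c · u) (lookup v j))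
               (sym (lookup-map i project V)))
        (comb-+ (comb-* (c · v) (<⇒≤ 0<c·v) (comb-there (comb-lookup V i)))
                (comb-* (- (c · u)) 0≤-c·u (comb-lookup (v ∷ V) zero)))
    where
    weight : ∀ a b → - b ≡ a + - b - 1ℚ * a
    weight = solve-∀ ℚring
    point : ∀ a x b y → a * x + - b * y ≡ a * x - b * y
    point = solve-∀ ℚring

  normalise : ∀ {s} → 1ℚ * (c · v) ≤ s → Comb (v ∷ V) s origin → Comb (v ∷ V) 1ℚ origin
  normalise {s} c·v≤s q =
    let ι , 0<ι , ι*s≡1 = reciprocal (<-≤-trans 0<c·v (subst (_≤ s) (*-identityˡ (c · v)) c·v≤s)) in
    subst₂ (Comb (v ∷ V)) ι*s≡1 (scale-origin ι) (comb-* ι (<⇒≤ 0<ι) q)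

  answer : Comb (map project V) 1ℚ origin ⊎ (∃ λ c′ → ∀ i → c′ · lookup (map project V) i < 0ℚ) →
           Comb (v ∷ V) 1ℚ origin ⊎ ∃ λ c′ → ∀ i → c′ · lookup (v ∷ V) i < 0ℚ
  answer (inj₁ p) = let _ , c·v≤s , q = projected p in inj₁ (normalise c·v≤s q)
  answer (inj₂ (c′ , h′)) = inj₂ (tilt V ⟦ e ⟧ v negative-on-V orthogonal v≢0)
    where
    -- The adjoint of `project` applied to c′: it vanishes at v and takes the value c′ · project u
    -- at each u.
    e = (c · v) ⊡ ⟨ c′ ⟩ ⊟ (c′ · v) ⊡ ⟨ c ⟩
    orthogonal : ⟦ e ⟧ · v ≡ 0ℚ
    orthogonal = trans (·-valueˡ e v) (lemma (c · v) (c′ · v))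
      where
      lemma : ∀ a b → a * b - b * a ≡ 0ℚ
      lemma = solve-∀ ℚring
    negative-on-V : ∀ i → ⟦ e ⟧ · lookup V i < 0ℚ
    negative-on-V i = subst (_< 0ℚ) eq (h′ i)
      where
      u = lookup V i
      lemma : ∀ a b x y → a * x - b * y ≡ a * x - y * b
      lemma = solve-∀ ℚring
      eq : c′ · lookup (map project V) i ≡ ⟦ e ⟧ · u
      eq = trans (cong (c′ ·_) (lookup-map i project V))
             (trans (·-value c′ ((c · v) ⊡ ⟨ u ⟩ ⊟ (c · u) ⊡ ⟨ v ⟩))
               (trans (lemma (c · v) (c · u) (c′ · u) (c′ · v)) (sym (·-valueˡ e u))))

-- Gordan's alternative for the generators translated by -y: the origin is a convex combination of
-- the translates exactly when y is one of the generators themselves.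
separate : (V : Vec (Point d) n) (y : Point d) → Conv V y ⊎ ∃ λ c → ∀ i → c · lookup V i < c · y
separate V y with gordan (map (_⊖ y) V)
... | inj₁ p = inj₁ (subst (Conv V) (trans (cong (origin ⊕_) (scale-1 y)) (⊕-identityˡ y)) (translate p))
  where
  translate : ∀ {t x} → Comb (map (_⊖ y) V) t x → Comb V t (x ⊕ scale t y)
  translate = comb-elim (λ t x → Comb V t (x ⊕ scale t y))
    (subst (Comb V 0ℚ) (sym (trans (cong (origin ⊕_) (scale-0 y)) (⊕-identityˡ origin))) (comb-0 V))
    (λ {s} {t} {x} {x′} p q → subst (Comb V (s + t))
       (point-≡ (⟨ x ⟩ ⊞ s ⊡ ⟨ y ⟩ ⊞ (⟨ x′ ⟩ ⊞ t ⊡ ⟨ y ⟩)) (⟨ x ⟩ ⊞ ⟨ x′ ⟩ ⊞ (s + t) ⊡ ⟨ y ⟩)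
          λ i → plus (lookup x i) (lookup x′ i) s t (lookup y i))
       (comb-+ p q))
    (λ {t} {x} k 0≤k p → subst (Comb V (k * t))
       (point-≡ (k ⊡ (⟨ x ⟩ ⊞ t ⊡ ⟨ y ⟩)) (k ⊡ ⟨ x ⟩ ⊞ (k * t) ⊡ ⟨ y ⟩)
          λ i → times k (lookup x i) t (lookup y i))
       (comb-* k 0≤k p))
    λ i → subst (Comb V 1ℚ)
       (sym (trans (cong (_⊕ scale 1ℚ y) (lookup-map i (_⊖ y) V))
         (point-≡ (⟨ lookup V i ⟩ ⊟ ⟨ y ⟩ ⊞ 1ℚ ⊡ ⟨ y ⟩) ⟨ lookup V i ⟩ λ j → cancel (lookup (lookup V i) j) (lookup y j))))
       (comb-lookup V i)
    where
    plus : ∀ x x′ s t y → x + s * y + (x′ + t * y) ≡ x + x′ + (s + t) * y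
    plus = solve-∀ ℚring
    times : ∀ k x t y → k * (x + t * y) ≡ k * x + k * t * y
    times = solve-∀ ℚring
    cancel : ∀ x y → x - y + 1ℚ * y ≡ x
    cancel = solve-∀ ℚring
... | inj₂ (c , h) = inj₂ (c , λ i → <-from (<0⇒0<neg (h i))
        (trans (cong -_ (trans (cong (c ·_) (lookup-map i (_⊖ y) V)) (·-value c (⟨ lookup V i ⟩ ⊟ ⟨ y ⟩))))
               (lemma (c · lookup V i) (c · y))))
  where
  lemma : ∀ a b → - (a - b) ≡ b - a
  lemma = solve-∀ ℚring

-- Exposed points

-- Uniqueness of the maximiser is stated for points and not for indices, since the list may contain
-- repetitions.
Exposes : Vec (Point d) n → Point d → Point d → Set
Exposes V a v = ∀ i → lookup V i ≡ v ⊎ a · lookup V i < a · v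

-- Among the maximisers of c, one of largest Euclidean norm is exposed by a small tilt of c towards itself.
expose : {D : Fin n → Set} → (∀ i → Dec (D i)) → (s : Fin n → Point d) (c : Point d) → ∃ D →
         ∃ λ j → ∃ λ c′ → D j × (∀ k → D k → c · s k ≤ c · s j) × (∀ k → D k → s k ≡ s j ⊎ c′ · s k < c′ · s j)
expose {D = D} D? s c nonempty =
  let j , Dⱼ , best = argmax {_≼_ = _≤ₗₑₓ_} ≤ₗₑₓ-total ≤ₗₑₓ-trans D? (λ k → c · s k , s k · s k) nonempty
      N , 0<N , dom = dominate (λ k → c · s k - c · s j) (λ k → s j · s k - s j · s j)
  in j , scale N c ⊕ s j , Dⱼ , (λ k Dₖ → ≤ₗₑₓ⇒≤ (best k Dₖ)) , λ k Dₖ → strict j N k (dom k) (best k Dₖ)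
  where
  tilted : ∀ N j k → (N * (c · s k - c · s j) + (s j · s k - s j · s j) < 0ℚ) →
           (scale N c ⊕ s j) · s k < (scale N c ⊕ s j) · s j
  tilted N j k h = <-from (<0⇒0<neg h)
    (trans (lemma N (c · s k) (c · s j) (s j · s k) (s j · s j))
      (sym (cong₂ _-_ (·-valueˡ (N ⊡ ⟨ c ⟩ ⊞ ⟨ s j ⟩) (s j)) (·-valueˡ (N ⊡ ⟨ c ⟩ ⊞ ⟨ s j ⟩) (s k)))))
    where
    lemma : ∀ N a b x y → - (N * (a - b) + (x - y)) ≡ N * b + y - (N * a + x)
    lemma = solve-∀ ℚring

  -- |x|² ≤ |y|² and x ≠ y force x·y < |y|², because |y - x|² > 0.
  cauchy : ∀ {x y : Point _} → x ≢ y → x · x ≤ y · y → y · x - y · y < 0ℚ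
  cauchy {x} {y} x≢y x≤y = <-from
    (0<*-cancelˡ {1ℚ + 1ℚ} { - (y · x - y · y)} (0≤+ 0≤1 0≤1) (subst (0ℚ <_) eq
      (0<+ (x≢0⇒0<x·x λ eq → x≢y (sym (⊖≡origin⇒≡ eq))) (≤⇒0≤- x≤y))))
    (sym (+-identityˡ (- (y · x - y · y))))
    where
    lemma : ∀ xx yy xy → yy - xy - (xy - xx) + (yy - xx) ≡ (1ℚ + 1ℚ) * - (xy - yy)
    lemma = solve-∀ ℚring
    eq : (y ⊖ x) · (y ⊖ x) + (y · y - x · x) ≡ (1ℚ + 1ℚ) * - (y · x - y · y)
    eq = trans (cong (_+ (y · y - x · x))
           (trans (·-value (y ⊖ x) (⟨ y ⟩ ⊟ ⟨ x ⟩))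
             (cong₂ _-_ (trans (·-valueˡ (⟨ y ⟩ ⊟ ⟨ x ⟩) y) (cong (λ z → y · y - z) (·-comm x y)))
                        (·-valueˡ (⟨ y ⟩ ⊟ ⟨ x ⟩) x))))
           (lemma (x · x) (y · y) (y · x))

  strict : ∀ j N k → (c · s k - c · s j < 0ℚ → N * (c · s k - c · s j) + (s j · s k - s j · s j) < 0ℚ) →
           (c · s k , s k · s k) ≤ₗₑₓ (c · s j , s j · s j) →
           s k ≡ s j ⊎ (scale N c ⊕ s j) · s k < (scale N c ⊕ s j) · s j
  strict j N k dom (inj₁ c<) = inj₂ (tilted N j k (dom
    (<-from (<⇒0<- c<) (lemma (c · s j) (c · s k)))))
    where
    lemma : ∀ a b → a - b ≡ 0ℚ - (b - a)
    lemma = solve-∀ ℚring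
  strict j N k dom (inj₂ (eq , norm≤)) = case s k ≟ₚ s j of λ where
      (yes sₖ≡sⱼ) → inj₁ sₖ≡sⱼ
      (no sₖ≢sⱼ)  → inj₂ (tilted N j k (subst (_< 0ℚ)
         (trans (lemma N (c · s j) (s j · s k - s j · s j))
           (cong (λ z → N * (z - c · s j) + (s j · s k - s j · s j)) (sym eq)))
         (cauchy sₖ≢sⱼ norm≤)))
    where
    lemma : ∀ N a x → x ≡ N * (a - a) + x
    lemma = solve-∀ ℚring

select : {A : Set} {B C : A → Set} (V : Vec A n) → (∀ i → B (lookup V i) ⊎ C (lookup V i)) →
         ∃ λ m → Σ (Vec A m) λ W →
           (∀ j → (∃ λ i → lookup V i ≡ lookup W j) × B (lookup W j)) ×
           (∀ i → (∃ λ j → lookup W j ≡ lookup V i) ⊎ C (lookup V i))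
select {B = B} {C} [] h = 0 , [] , (λ ()) , λ ()
select {B = B} {C} (v ∷ V) h with select {B = B} {C} V (h ∘ suc) | h zero
... | m , W , W⊆B , V⊆W | inj₁ b = suc m , v ∷ W ,
    (λ where
      zero    → (zero , refl) , b
      (suc j) → let (i , eq) , b′ = W⊆B j in (suc i , eq) , b′) ,
    λ where
      zero    → inj₁ (zero , refl)
      (suc i) → [ (λ (j , eq) → inj₁ (suc j , eq)) , inj₂ ]′ (V⊆W i)
... | m , W , W⊆B , V⊆W | inj₂ c = m , W ,
    (λ j → let (i , eq) , b′ = W⊆B j in (suc i , eq) , b′) ,
    λ where
      zero    → inj₂ c
      (suc i) → V⊆W i

-- The search for a functional becomes finite by separating v from the generators different from v:
-- a separating functional exposes v, and if v is a convex combination of those generators, no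
-- functional is strictly larger at v than at all of them.
decide-exposed : (V : Vec (Point d) n) (v : Point d) → (∃ λ a → Exposes V a v) ⊎ ¬ ∃ λ a → Exposes V a v
decide-exposed V v =
  let m , W , W⊆ , ⊆W = select {B = _≢ v} {C = _≡ v} V (λ i → ≢⊎≡ (lookup V i ≟ₚ v))
  in [ (λ v∈W → inj₂ (redundant W W⊆ v∈W)) ,
       (λ (a , h) → inj₁ (a , λ i →
          [ (λ (j , Wⱼ≡Vᵢ) → inj₂ (subst (λ u → a · u < a · v) Wⱼ≡Vᵢ (h j))) , inj₁ ]′ (⊆W i))) ]′
     (separate W v)
  where
  ≢⊎≡ : ∀ {x y : Point _} → Dec (x ≡ y) → x ≢ y ⊎ x ≡ y
  ≢⊎≡ (yes eq)  = inj₂ eq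
  ≢⊎≡ (no neq) = inj₁ neq
  redundant : ∀ {m} (W : Vec (Point _) m) → (∀ j → (∃ λ i → lookup V i ≡ lookup W j) × lookup W j ≢ v) →
              Conv W v → ¬ ∃ λ a → Exposes V a v
  -- All generators in `W` lie strictly below the level a · v, so the face at that level is spanned
  -- by the empty list.
  redundant W W⊆ v∈W (a , ex) = conv-empty (conv-face {U = []} a below v∈W refl)
    where
    conv-empty : ¬ Conv {n = 0} [] v
    conv-empty v∈[] = case conv-nonempty v∈[] of λ ()
    below : ∀ j → (a · lookup W j ≡ a · v × Comb [] 1ℚ (lookup W j)) ⊎ a · lookup W j < a · v
    below j = let (i , eq) , w≢v = W⊆ j in
      inj₂ (subst (λ u → a · u < a · v) eq
        ([ (λ Vᵢ≡v → contradiction (trans (sym eq) Vᵢ≡v) w≢v) , id ]′ (ex i)))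

-- A finite Minkowski theorem. A functional separating a point of the hull from the exposed
-- generators would, by `expose`, attain its maximum over V at an exposed generator, a
-- contradiction.
exposed-generators : (V : Vec (Point d) n) →
  ∃ λ m → Σ (Vec (Point d) m) λ W →
    (∀ j → (∃ λ i → lookup V i ≡ lookup W j) × ∃ λ a → Exposes V a (lookup W j)) × (Conv V ⊆ Conv W)
exposed-generators V =
  let m , W , W⊆ , ⊆W = select {B = λ v → ∃ λ a → Exposes V a v} {C = λ v → ¬ ∃ λ a → Exposes V a v} V
                         (λ i → decide-exposed V (lookup V i))
  in m , W , W⊆ , λ x x∈V → [ id , (λ (c , h) → ⊥-elim (absurd W ⊆W x∈V c h)) ]′ (separate W x)
  where
  absurd : ∀ {m} (W : Vec (Point _) m) →
    (∀ i → (∃ λ j → lookup W j ≡ lookup V i) ⊎ ¬ ∃ λ a → Exposes V a (lookup V i)) →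
    ∀ {x} → Conv V x → ∀ c → ¬ (∀ j → c · lookup W j < c · x)
  absurd W ⊆W {x} x∈V c h =
    let i , a , _ , max , ex = expose {D = λ _ → ⊤} (λ _ → yes tt) (lookup V) c (conv-nonempty x∈V , tt)
    in [ (λ (j , eq) → <-irrefl refl
            (<-≤-trans (subst (λ u → c · u < c · x) eq (h j)) (conv-≤ c (λ k → max k tt) x∈V))) ,
         (λ ¬ex → ¬ex (a , λ k → ex k tt)) ]′ (⊆W i)

-- Carathéodory's theorem

-- Row selection for Gaussian elimination. The last component says that every row is p or occurs in
-- `R′`, phrased as transport of properties so that no permutation of rows has to be recorded.
pivot : (R : Vec (Vec ℚ (suc n)) m) →
        (∀ j → head (lookup R j) ≡ 0ℚ) ⊎
        ∃ λ m′ → m ≡ suc m′ × Σ (Vec (Vec ℚ (suc n)) m′) λ R′ → ∃ λ p → head p ≢ 0ℚ ×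
          ((P : Vec ℚ (suc n) → Set) → P p → (∀ j → P (lookup R′ j)) → ∀ j → P (lookup R j))
pivot [] = inj₁ λ ()
pivot (r ∷ R) with head r ≟ 0ℚ | pivot R
... | no r₀≢0 | _ = inj₂ (_ , refl , R , r , r₀≢0 , λ where
    P Pr PR zero    → Pr
    P Pr PR (suc j) → PR j)
... | yes r₀≡0 | inj₁ R₀≡0 = inj₁ λ where
    zero    → r₀≡0
    (suc j) → R₀≡0 j
... | yes r₀≡0 | inj₂ (m′ , refl , R′ , p , p₀≢0 , R′⇒R) = inj₂ (suc m′ , refl , r ∷ R′ , p , p₀≢0 , λ where
    P Pp PR′ zero    → PR′ zero
    P Pp PR′ (suc j) → R′⇒R P Pp (PR′ ∘ suc) j)

scale≢origin : ∀ {k} {x : Point d} → k ≢ 0ℚ → x ≢ origin → scale k x ≢ origin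
scale≢origin {d} {k} {x} k≢0 x≢0 eq = <⇒≢ (0<* (0<sq k≢0) (x≢0⇒0<x·x x≢0))
  (trans (sym (*-zeroʳ k)) (trans (cong (k *_) (trans (sym (·-value x (𝟎 {d}))) (cong (x ·_) (sym eq))))
    (trans (cong (k *_) (·-value x (k ⊡ ⟨ x ⟩))) (sym (*-assoc k k (x · x))))))

-- A zero first column is solved by the first unit vector. Otherwise a pivot row removes the first
-- unknown, and back substitution scales the smaller solution by `p₀`, which avoids dividing by it.
null-vector : (R : Vec (Point n) m) → m ℕ.< n → ∃ λ x → x ≢ origin × ∀ j → lookup R j · x ≡ 0ℚ
null-vector {zero} R ()
null-vector {suc n} R m<n with pivot R
... | inj₁ R₀≡0 = 1ℚ ∷ origin , (λ eq → 1≢0 (∷-injectiveˡ eq)) , λ j → kill (lookup R j) (R₀≡0 j)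
  where
  kill : ∀ r → head r ≡ 0ℚ → r · (1ℚ ∷ origin) ≡ 0ℚ
  kill (_ ∷ r) refl = cong (λ z → 0ℚ * 1ℚ + z) (·-value r 𝟎)
... | inj₂ (m′ , refl , R′ , p₀ ∷ p , p₀≢0 , R′⇒R) =
  let x , x≢0 , null = null-vector (map reduce R′) (ℕ.≤-pred m<n)
  in - (p · x) ∷ scale p₀ x , (λ eq → scale≢origin p₀≢0 x≢0 (cong tail eq)) ,
     R′⇒R (λ r → r · (- (p · x) ∷ scale p₀ x) ≡ 0ℚ)
       (extend x (p₀ ∷ p) (trans (·-valueˡ (p₀ ⊡ ⟨ p ⟩ ⊟ p₀ ⊡ ⟨ p ⟩) x) (+-inverseʳ (p₀ * (p · x)))))
       (λ j → extend x (lookup R′ j) (trans (cong (_· x) (sym (lookup-map j reduce R′))) (null j)))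
  where
  reduce : Vec ℚ (suc n) → Vec ℚ n
  reduce r = scale p₀ (tail r) ⊖ scale (head r) p

  lemma : ∀ a b s t → a * - s + b * t ≡ b * t - a * s
  lemma = solve-∀ ℚring

  extend : ∀ x r → reduce r · x ≡ 0ℚ → r · (- (p · x) ∷ scale p₀ x) ≡ 0ℚ
  extend x (r₀ ∷ r) eq =
    trans (cong (λ z → r₀ * - (p · x) + z) (·-value r (p₀ ⊡ ⟨ x ⟩)))
      (trans (lemma r₀ p₀ (p · x) (r · x))
        (trans (sym (·-valueˡ (p₀ ⊡ ⟨ r ⟩ ⊟ r₀ ⊡ ⟨ p ⟩) x)) eq))

ones : Vec ℚ n
ones = replicate _ 1ℚ

ones· : (w : Vec ℚ n) → ones · w ≡ sumℚ w
ones· []      = refl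
ones· (k ∷ w) = cong₂ _+_ (*-identityˡ k) (ones· w)

coordinates : Vec (Point d) n → Fin d → Vec ℚ n
coordinates V i = map (λ v → lookup v i) V

coordinates· : (V : Vec (Point d) n) (w : Vec ℚ n) (i : Fin d) → lookup (lincomb w V) i ≡ coordinates V i · w
coordinates· [] [] i           = lookup-replicate i 0ℚ
coordinates· (v ∷ V) (k ∷ w) i =
  trans (Linear.value-homo (lookup-linear i) (k ⊡ ⟨ v ⟩ ⊞ ⟨ lincomb w V ⟩))
    (cong₂ _+_ (*-comm k (lookup v i)) (coordinates· V w i))

-- The d coordinate rows and the row of ones are d + 1 homogeneous equations in n > d + 1 unknowns.
affine-dependence : (V : Vec (Point d) n) → suc d ℕ.< n →
                    ∃ λ α → α ≢ origin × ones · α ≡ 0ℚ × ∀ i → coordinates V i · α ≡ 0ℚ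
affine-dependence V d<n =
  let α , α≢0 , null = null-vector (ones ∷ tabulate (coordinates V)) d<n
  in α , α≢0 , null zero ,
     λ i → trans (cong (_· α) (sym (lookup∘tabulate (coordinates V) i))) (null (suc i))

positive-entry : (α : Vec ℚ n) → α ≢ origin → ones · α ≡ 0ℚ → ∃ λ i → 0ℚ < lookup α i
positive-entry α α≢0 sum≡0 with any? (λ i → 0ℚ <? lookup α i)
... | yes found = found
... | no none = contradiction
    (proj₂ (all-zero α λ i → ≮⇒≥ λ 0<αᵢ → none (i , 0<αᵢ)) (trans (sym (ones· α)) sum≡0)) α≢0
  where
  all-zero : (α : Vec ℚ n) → (∀ i → lookup α i ≤ 0ℚ) → sumℚ α ≤ 0ℚ × (sumℚ α ≡ 0ℚ → α ≡ origin)
  all-zero [] _ = ≤-refl , λ _ → refl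
  all-zero (a ∷ α) h =
    let a≤0 = h zero ; α≤0 , α≡0 = all-zero α (h ∘ suc) in
    +-mono-≤ a≤0 α≤0 , λ eq → cong₂ _∷_
      (≤∧≮⇒≡ a≤0 λ a<0 → <⇒≢ (+-mono-<-≤ a<0 α≤0) eq)
      (α≡0 (≤∧≮⇒≡ α≤0 λ α<0 → <⇒≢ (+-mono-≤-< a≤0 α<0) eq))

-- The default value 0 makes the inverse total, so that quotients can be functions on all indices,
-- including those with no positive divisor.
inverse : ∀ p → ∃ λ ι → 0ℚ < p → 0ℚ < ι × ι * p ≡ 1ℚ
inverse p with 0ℚ <? p
... | yes 0<p = let ι , h = reciprocal 0<p in ι , λ _ → h
... | no 0≮p  = 0ℚ , λ 0<p → contradiction 0<p 0≮p

-- The ratio test of the simplex method: t is the least w i / α i over the positive α i, the moment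
-- when a first weight reaches 0 along the direction -α.
critical-step : (w α : Vec ℚ n) → (∀ i → 0ℚ ≤ lookup w i) → (∃ λ i → 0ℚ < lookup α i) →
  ∃ λ t → (∀ i → 0ℚ ≤ lookup w i - t * lookup α i) × ∃ λ i → lookup w i - t * lookup α i ≡ 0ℚ
critical-step w α 0≤w pos =
  let i , 0<αᵢ , least = argmax {_≼_ = _≥_} (λ p q → ≤-total q p) (λ q≤p r≤q → ≤-trans r≤q q≤p)
                           (λ i → 0ℚ <? lookup α i) ratio pos
  in ratio i , (λ j → feasible (ratio i) (0≤ratio i 0<αᵢ) j (least j)) , i ,
     trans (cong (_- ratio i * lookup α i) (sym (ratio*α i 0<αᵢ))) (+-inverseʳ (ratio i * lookup α i))
  where
  ratio : Fin _ → ℚ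
  ratio i = lookup w i * proj₁ (inverse (lookup α i))

  0≤ratio : ∀ i → 0ℚ < lookup α i → 0ℚ ≤ ratio i
  0≤ratio i 0<αᵢ = 0≤* (0≤w i) (<⇒≤ (proj₁ (proj₂ (inverse (lookup α i)) 0<αᵢ)))

  ratio*α : ∀ i → 0ℚ < lookup α i → ratio i * lookup α i ≡ lookup w i
  ratio*α i 0<αᵢ = trans (*-assoc (lookup w i) _ (lookup α i))
    (trans (cong (lookup w i *_) (proj₂ (proj₂ (inverse (lookup α i)) 0<αᵢ))) (*-identityʳ (lookup w i)))

  factor : ∀ a b c → (a - b) * c ≡ a * c - b * c
  factor = solve-∀ ℚring
  negate : ∀ w t a → w + t * - a ≡ w - t * a
  negate = solve-∀ ℚring

  feasible : ∀ t → 0ℚ ≤ t → ∀ j → (0ℚ < lookup α j → t ≤ ratio j) → 0ℚ ≤ lookup w j - t * lookup α j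
  feasible t 0≤t j t≤ = case 0ℚ <? lookup α j of λ where
    (yes 0<αⱼ) → subst (0ℚ ≤_)
      (trans (factor (ratio j) t (lookup α j)) (cong (_- t * lookup α j) (ratio*α j 0<αⱼ)))
      (0≤* (≤⇒0≤- (t≤ 0<αⱼ)) (<⇒≤ 0<αⱼ))
    (no 0≮αⱼ) → subst (0ℚ ≤_) (negate (lookup w j) t (lookup α j))
      (0≤+ (0≤w j) (0≤* 0≤t (neg-antimono-≤ (≮⇒≥ 0≮αⱼ))))

SubVec : Vec (Point d) m → Vec (Point d) n → Set
SubVec W V = ∀ j → ∃ λ i → lookup V i ≡ lookup W j

discard : (V : Vec (Point d) (suc n)) (w : Vec ℚ (suc n)) → (∀ i → 0ℚ ≤ lookup w i) →
          (∃ λ i → lookup w i ≡ 0ℚ) → Σ (Vec (Point d) n) λ W → SubVec W V × Comb W (sumℚ w) (lincomb w V)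
discard (v ∷ V) (k ∷ w) 0≤w (zero , refl) = V , (λ j → suc j , refl) ,
  subst₂ (Comb V) (sym (+-identityˡ (sumℚ w)))
    (sym (trans (cong (_⊕ lincomb w V) (scale-0 v)) (⊕-identityˡ (lincomb w V))))
    (w , lookup⁻ (0≤w ∘ suc) , refl , refl)
discard {n = suc n} (v ∷ V) (k ∷ w) 0≤w (suc i , wᵢ≡0) =
  let W , W⊆V , h = discard V w (0≤w ∘ suc) (i , wᵢ≡0) in
  v ∷ W , (λ where
    zero    → zero , refl
    (suc j) → let i , eq = W⊆V j in suc i , eq) ,
  comb-∷ (0≤w zero) h

-- Moving the weights along an affine dependence changes neither their sum nor the point
-- represented; the move stops when a weight vanishes, and its generator is dropped.
carathéodory-step : (V : Vec (Point d) (suc n)) → d ℕ.< n → ∀ {t x} → Comb V t x →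
                    Σ (Vec (Point d) n) λ W → SubVec W V × Comb W t x
carathéodory-step V d<n (w , 0≤w , refl , refl) =
  let α , α≢0 , sum≡0 , null = affine-dependence V (s≤s d<n)
      t , 0≤w-tα , i , critical = critical-step w α (lookup⁺ 0≤w) (positive-entry α α≢0 sum≡0)
      e = ⟨ w ⟩ ⊟ t ⊡ ⟨ α ⟩
      entry = λ j → Linear.value-homo (lookup-linear j) e
      W , W⊆V , h = discard V ⟦ e ⟧ (λ j → subst (0ℚ ≤_) (sym (entry j)) (0≤w-tα j)) (i , trans (entry i) critical)
  in W , W⊆V , subst₂ (Comb W)
       (trans (sym (ones· ⟦ e ⟧)) (trans (unchanged ones w t α sum≡0) (ones· w)))
       (lookup-extensionality λ j → trans (coordinates· V ⟦ e ⟧ j)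
         (trans (unchanged (coordinates V j) w t α (null j)) (sym (coordinates· V w j))))
       h
  where
  lemma : ∀ s t → s - t * 0ℚ ≡ s
  lemma = solve-∀ ℚring
  unchanged : ∀ r w t α → r · α ≡ 0ℚ → r · (w ⊖ scale t α) ≡ r · w
  unchanged r w t α r·α≡0 = trans (·-value r (⟨ w ⟩ ⊟ t ⊡ ⟨ α ⟩))
    (trans (cong (λ z → r · w - t * z) r·α≡0) (lemma (r · w) t))

-- The detour through unnormalised fractions avoids the gcds of normalised arithmetic, so identities
-- between integers seen as rationals become integer identities.
fromℚᵘ-homo-* : ∀ p q → fromℚᵘ p * fromℚᵘ q ≡ fromℚᵘ (p ℚᵘ.* q)
fromℚᵘ-homo-* p q = trans (sym (fromℚᵘ-toℚᵘ (fromℚᵘ p * fromℚᵘ q)))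
  (fromℚᵘ-cong (ℚᵘ.≃-trans (toℚᵘ-homo-* (fromℚᵘ p) (fromℚᵘ q)) (ℚᵘ.*-cong (toℚᵘ-fromℚᵘ p) (toℚᵘ-fromℚᵘ q))))

fromℚᵘ-homo-+ : ∀ p q → fromℚᵘ p + fromℚᵘ q ≡ fromℚᵘ (p ℚᵘ.+ q)
fromℚᵘ-homo-+ p q = trans (sym (fromℚᵘ-toℚᵘ (fromℚᵘ p + fromℚᵘ q)))
  (fromℚᵘ-cong (ℚᵘ.≃-trans (toℚᵘ-homo-+ (fromℚᵘ p) (fromℚᵘ q)) (ℚᵘ.+-cong (toℚᵘ-fromℚᵘ p) (toℚᵘ-fromℚᵘ q))))

ℤtoℚ-* : ∀ i j → ℤtoℚ (i ℤ.* j) ≡ ℤtoℚ i * ℤtoℚ j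
ℤtoℚ-* i j = sym (fromℚᵘ-homo-* (mkℚᵘ i 0) (mkℚᵘ j 0))

ℕtoℚ-suc : ∀ n → ℕtoℚ (suc n) ≡ 1ℚ + ℕtoℚ n
ℕtoℚ-suc n = trans (cong (λ i → (int 1 ℤ.+ i) / 1) (sym (ℤ.*-identityʳ (int n))))
  (sym (fromℚᵘ-homo-+ (mkℚᵘ (int 1) 0) (mkℚᵘ (int n) 0)))

ℕtoℚ-mono-≤ : m ℕ.≤ n → ℕtoℚ m ≤ ℕtoℚ n
ℕtoℚ-mono-≤ {n = n} z≤n = nonNegative⁻¹ (ℕtoℚ n) {{normalize-nonNeg n 1}}
ℕtoℚ-mono-≤ (s≤s {m} {n} m≤n) =
  subst₂ _≤_ (sym (ℕtoℚ-suc m)) (sym (ℕtoℚ-suc n)) (+-monoʳ-≤ 1ℚ (ℕtoℚ-mono-≤ m≤n))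

-- Pigeonhole: n + 1 weights of sum at least n + 1 cannot all be below 1, and one unit can be taken
-- from a weight that is not.
heavy-generator : (V : Vec (Point d) (suc n)) → ∀ {t x} → ℕtoℚ n + 1ℚ ≤ t → Comb V t x →
                  ∃ λ i → ∃ λ y → Comb V (t - 1ℚ) y × x ≡ lookup V i ⊕ y
heavy-generator {n = n} (v ∷ V) n+1≤t (k ∷ w , 0≤k ∷ 0≤w , refl , refl) with 1ℚ ≤? k
... | yes 1≤k = zero , scale (k - 1ℚ) v ⊕ lincomb w V ,
    subst (λ t → Comb (v ∷ V) t (scale (k - 1ℚ) v ⊕ lincomb w V)) (weight k (sumℚ w))
      (comb-∷ (≤⇒0≤- 1≤k) (w , 0≤w , refl , refl)) ,
    point-≡ (k ⊡ ⟨ v ⟩ ⊞ ⟨ lincomb w V ⟩) (⟨ v ⟩ ⊞ ((k - 1ℚ) ⊡ ⟨ v ⟩ ⊞ ⟨ lincomb w V ⟩))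
      λ i → split k (lookup v i) (lookup (lincomb w V) i)
  where
  weight : ∀ k s → k - 1ℚ + s ≡ k + s - 1ℚ
  weight = solve-∀ ℚring
  split : ∀ k v x → k * v + x ≡ v + ((k - 1ℚ) * v + x)
  split = solve-∀ ℚring
heavy-generator {n = zero} (v ∷ []) 1≤t (k ∷ [] , _ , refl , refl) | no 1≰k =
  contradiction (subst₂ _≤_ (+-identityˡ 1ℚ) (+-identityʳ k) 1≤t) 1≰k
heavy-generator {n = suc n} (v ∷ V) n+1≤t (k ∷ w , 0≤k ∷ 0≤w , refl , refl) | no 1≰k =
  let i , y , h , eq = heavy-generator V
        (≤-from (0≤+ (≤⇒0≤- n+1≤t) (≤⇒0≤- (<⇒≤ (≰⇒> 1≰k))))
          (trans (cong (λ z → k + sumℚ w - (z + 1ℚ) + (1ℚ - k)) (ℕtoℚ-suc n)) (bound k (sumℚ w) (ℕtoℚ n))))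
        (w , 0≤w , refl , refl)
  in suc i , scale k v ⊕ y ,
     subst (λ t → Comb (v ∷ V) t (scale k v ⊕ y)) (sym (+-assoc k (sumℚ w) (- 1ℚ))) (comb-∷ 0≤k h) ,
     trans (cong (scale k v ⊕_) eq)
       (point-≡ (k ⊡ ⟨ v ⟩ ⊞ (⟨ lookup V i ⟩ ⊞ ⟨ y ⟩)) (⟨ lookup V i ⟩ ⊞ (k ⊡ ⟨ v ⟩ ⊞ ⟨ y ⟩))
         λ j → swap (k * lookup v j) (lookup (lookup V i) j) (lookup y j))
  where
  bound : ∀ k s n → k + s - (1ℚ + n + 1ℚ) + (1ℚ - k) ≡ s - (n + 1ℚ)
  bound = solve-∀ ℚring
  swap : ∀ a b c → a + (b + c) ≡ b + (a + c)
  swap = solve-∀ ℚring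

-- By Carathéodory a point of (d + 1) conv V is a combination of at most d + 1 generators, so one has weight ≥ 1.
extract-generator : (V : Vec (Point d) n) → ∀ {x} → Comb V (ℕtoℚ d + 1ℚ) x →
                    ∃ λ i → ∃ λ y → Comb V (ℕtoℚ d) y × x ≡ lookup V i ⊕ y
extract-generator {d} {zero} [] ([] , [] , 0≡d+1 , _) =
  contradiction 0≡d+1 (<⇒≢ (+-mono-≤-< (ℕtoℚ-mono-≤ (z≤n {d})) 0<1))
extract-generator {d} {suc n} V h with n ℕ.≤? d
... | yes n≤d =
  let i , y , h′ , eq = heavy-generator V (+-monoˡ-≤ 1ℚ (ℕtoℚ-mono-≤ n≤d)) h
  in i , y , subst (λ t → Comb V t y) (cancel (ℕtoℚ d)) h′ , eq
  where
  cancel : ∀ a → a + 1ℚ - 1ℚ ≡ a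
  cancel = solve-∀ ℚring
... | no n≰d =
  let W , W⊆V , h′ = carathéodory-step V (ℕ.≰⇒> n≰d) h
      j , y , h″ , x≡ = extract-generator W h′
      i , Vᵢ≡Wⱼ = W⊆V j
  in i , y , comb-bind (λ j → let i , eq = W⊆V j in subst (Comb V 1ℚ) eq (comb-lookup V i)) h″ ,
     trans x≡ (cong (_⊕ y) (sym Vᵢ≡Wⱼ))

-- Primitive vectors

*-denominator : ∀ r → r * ℤtoℚ (int (↧ₙ r)) ≡ ℤtoℚ (↥ r)
*-denominator r@(mkℚ a b-1 _) =
  trans (cong (_* ℤtoℚ (int (suc b-1))) (sym (fromℚᵘ-toℚᵘ r)))
    (trans (fromℚᵘ-homo-* (mkℚᵘ a b-1) (mkℚᵘ (int (suc b-1)) 0))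
      (fromℚᵘ-cong {mkℚᵘ a b-1 ℚᵘ.* mkℚᵘ (int (suc b-1)) 0} {mkℚᵘ a 0} (ℚᵘ.*≡* (ℤ.*-assoc a (int (suc b-1)) (int 1)))))

-- Induction on coordinates. If the tail is k u and q / k = a / b in lowest terms, then the vector
-- is (k / b) (a, b u). A common divisor of a and b u is coprime to b, hence divides u and is 1.
primitive-multiple : (e : Point d) → e ≡ origin ⊎ ∃ λ k → k ≢ 0ℚ × LatticeMultiple e k
primitive-multiple [] = inj₁ refl
primitive-multiple (q ∷ e) with primitive-multiple e | q ≟ 0ℚ
... | inj₁ refl | yes refl = inj₁ refl
... | inj₁ refl | no q≢0 = inj₂ (q , q≢0 , int 1 ∷ replicate _ (int 0) , (λ m m∣ → ∣1⇒≡1 (m∣ zero)) ,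
    cong₂ _∷_ (sym (*-identityʳ q)) (zeros q))
  where
  zeros : ∀ {d} k → origin {d} ≡ scale k (map ℤtoℚ (replicate d (int 0)))
  zeros {zero}  k = refl
  zeros {suc d} k = cong₂ _∷_ (sym (*-zeroʳ k)) (zeros k)
... | inj₂ (k , k≢0 , u , u-prim , refl) | _ =
  inj₂ (k * ι , k*ι≢0 , a ∷ map (int b ℤ.*_) u , prim , cong₂ _∷_ q≡ (lookup-extensionality tail≡))
  where
  instance
    nz : NonZero k
    nz = ≢-nonZero k≢0
  r = 1/ k * q
  a = ↥ r
  b = ↧ₙ r

  0<b : 0ℚ < ℤtoℚ (int b)
  0<b = positive⁻¹ (ℤtoℚ (int b)) {{normalize-pos b 1}}

  ι = proj₁ (reciprocal 0<b)
  ι*b≡1 : ι * ℤtoℚ (int b) ≡ 1ℚ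
  ι*b≡1 = proj₂ (proj₂ (reciprocal 0<b))

  regroup : ∀ k ι b x → k * ι * (b * x) ≡ ι * b * (k * x)
  regroup = solve-∀ ℚring

  q≡ : q ≡ k * ι * ℤtoℚ a
  q≡ = trans (sym (*-identityˡ q)) (trans (cong (_* q) (sym ι*b≡1))
        (trans (cong (λ z → ι * ℤtoℚ (int b) * z) (trans (sym (*-identityˡ q))
            (trans (cong (_* q) (sym (*-inverseʳ k))) (*-assoc k (1/ k) q))))
          (trans (sym (regroup k ι (ℤtoℚ (int b)) r))
            (cong (λ z → k * ι * z) (trans (*-comm (ℤtoℚ (int b)) r) (*-denominator r))))))

  tail≡ : ∀ i → lookup (scale k (map ℤtoℚ u)) i ≡ lookup (scale (k * ι) (map ℤtoℚ (map (int b ℤ.*_) u))) i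
  tail≡ i =
    trans (lookup-map i (k *_) (map ℤtoℚ u)) (trans (cong (k *_) (lookup-map i ℤtoℚ u))
     (trans (sym (*-identityˡ (k * ℤtoℚ (lookup u i)))) (trans (cong (_* (k * ℤtoℚ (lookup u i))) (sym ι*b≡1))
      (trans (sym (regroup k ι (ℤtoℚ (int b)) (ℤtoℚ (lookup u i))))
       (trans (cong (λ z → k * ι * z) (trans (sym (ℤtoℚ-* (int b) (lookup u i)))
           (trans (cong ℤtoℚ (sym (lookup-map i (int b ℤ.*_) u))) (sym (lookup-map i ℤtoℚ (map (int b ℤ.*_) u))))))
        (sym (lookup-map i (λ z → k * ι * z) (map ℤtoℚ (map (int b ℤ.*_) u)))))))))

  k*ι≢0 : k * ι ≢ 0ℚ
  k*ι≢0 eq = k≢0 (trans (sym (*-identityʳ k)) (trans (cong (k *_) (sym ι*b≡1))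
    (trans (sym (*-assoc k ι (ℤtoℚ (int b)))) (trans (cong (_* ℤtoℚ (int b)) eq) (*-zeroˡ (ℤtoℚ (int b)))))))

  prim : Primitive (a ∷ map (int b ℤ.*_) u)
  prim m m∣ = u-prim m λ i → coprime-divisor m⊥b
    (subst (m ∣_) (trans (cong ℤ.∣_∣ (lookup-map i (int b ℤ.*_) u)) (ℤ.abs-* (int b) (lookup u i))) (m∣ (suc i)))
    where
    m⊥b : Coprimality.Coprime m b
    m⊥b (i∣m , i∣b) = reduced-coprime r (∣-trans i∣m (m∣ zero) , i∣b)
      where
      reduced-coprime : ∀ r → Coprimality.Coprime ℤ.∣ ↥ r ∣ (↧ₙ r)
      reduced-coprime (mkℚ _ _ c) = Coprimality.recompute c

-- Edges at an exposed vertex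

conv-≥ : ∀ {V : Vec (Point d) n} c {M} → (∀ i → M ≤ c · lookup V i) → ∀ {x} → Conv V x → M ≤ c · x
conv-≥ {V = V} c {M} h {x} v = subst₂ _≤_ (neg-involutive M) (trans (cong -_ (opposite x)) (neg-involutive (c · x)))
  (neg-antimono-≤ (conv-≤ (scale (- 1ℚ) c)
    (λ i → subst (_≤ - M) (sym (opposite (lookup V i))) (neg-antimono-≤ (h i))) v))
  where
  neg-involutive : ∀ p → - (- p) ≡ p
  neg-involutive = solve-∀ ℚring
  lemma : ∀ p → - 1ℚ * p ≡ - p
  lemma = solve-∀ ℚring
  opposite : ∀ y → scale (- 1ℚ) c · y ≡ - (c · y)
  opposite y = trans (·-valueˡ ((- 1ℚ) ⊡ ⟨ c ⟩) y) (lemma (c · y))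

exposes⇒≤ : (V : Vec (Point d) n) (a : Point d) → ∀ {v} → Exposes V a v → ∀ i → a · lookup V i ≤ a · v
exposes⇒≤ V a ex i = [ (λ eq → ≤-reflexive (cong (a ·_) eq)) , <⇒≤ ]′ (ex i)

exposes⇒vertex : (V : Vec (Point d) n) (a : Point d) → ∀ {v} → Conv V v → Exposes V a v → IsVertex (Conv V) v
exposes⇒vertex V a {v} v∈V ex = (v , refl) , a , λ x → mk⇔
  (λ { refl → v∈V , λ y y∈V → conv-≤ a (exposes⇒≤ V a ex) y∈V })
  (λ (x∈V , max) → comb-singleton (conv-face a
     (λ i → [ (λ { eq → inj₁ (cong (a ·_) eq , subst (Comb (v ∷ []) 1ℚ) (sym eq) (comb-lookup (v ∷ []) zero)) }) , inj₂ ]′ (ex i))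
     x∈V (≤-antisym (conv-≤ a (exposes⇒≤ V a ex) x∈V) (max v v∈V))))

segment-face : (V : Vec (Point d) n) → ∀ {v w} b → Conv V v → Conv V w → b · v ≡ b · w →
  (∀ y → Conv V y → b · y ≤ b · v) → (∀ y → Conv V y → b · y ≡ b · v → Conv (v ∷ w ∷ []) y) →
  IsFace (Conv V) (Conv (v ∷ w ∷ []))
segment-face V {v} {w} b v∈V w∈V b·v≡b·w max onto = (v , comb-lookup (v ∷ w ∷ []) zero) , b , λ x → mk⇔
  (λ x∈vw → comb-bind (λ { zero → v∈V ; (suc zero) → w∈V }) x∈vw ,
     λ y y∈V → conv-≥ b (λ { zero → max y y∈V ; (suc zero) → subst (b · y ≤_) b·v≡b·w (max y y∈V) }) x∈vw)
  (λ (x∈V , max′) → onto x x∈V (≤-antisym (max x x∈V) (max′ v v∈V)))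

-- An edge seen from the generators: b attains its maximum over V at the two endpoints and their
-- repetitions, and nowhere else. When the endpoints are exposed, this is what a simplex step
-- travels along.
record Edge (V : Vec (Point d) n) (i j : Fin n) (b : Point d) : Set where
  field
    distinct : lookup V i ≢ lookup V j
    level    : b · lookup V i ≡ b · lookup V j
    below    : ∀ k → (lookup V k ≡ lookup V i ⊎ lookup V k ≡ lookup V j) ⊎ b · lookup V k < b · lookup V i

  bounded : ∀ k → b · lookup V k ≤ b · lookup V i
  bounded k = [ [ (λ eq → ≤-reflexive (cong (b ·_) eq)) ,
                  (λ eq → ≤-reflexive (trans (cong (b ·_) eq) (sym level))) ]′ , <⇒≤ ]′ (below k)

reverse : ∀ {V : Vec (Point d) n} {i j b} → Edge V i j b → Edge V j i b
reverse {V = V} {b = b} E = record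
  { distinct = distinct ∘ sym
  ; level    = sym level
  ; below    = λ k → [ (λ { (inj₁ eq) → inj₁ (inj₂ eq) ; (inj₂ eq) → inj₁ (inj₁ eq) }) ,
                       (λ b< → inj₂ (subst (b · lookup V k <_) level b<)) ]′ (below k)
  }
  where open Edge E

-- The vertex figure at v i: with a exposing v i, the rays towards the other vertices are cut by the
-- hyperplane a·x = -1 (x measured from v i). An extreme point of this section spans an edge.
module VertexFigure (V : Vec (Point d) n) (exposed : ∀ j → ∃ λ a → Exposes V a (lookup V j))
                    (i : Fin n) where
  private
    v : Fin n → Point d
    v = lookup V
    a : Point d
    a = proj₁ (exposed i)

  depth : Fin n → ℚ
  depth k = a · v i - a · v k

  -- Copies of v i have depth 0 and are sent to the origin by the default value of `inverse`; the
  -- facts below about `section k` assume v k ≢ v i.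
  section : Fin n → Point d
  section k = scale (proj₁ (inverse (depth k))) (v k ⊖ v i)

  exposes⇒< : ∀ k l → v l ≢ v k → proj₁ (exposed k) · v l < proj₁ (exposed k) · v k
  exposes⇒< k l vₗ≢vₖ = [ (λ eq → contradiction eq vₗ≢vₖ) , id ]′ (proj₂ (exposed k) l)

  0<depth : ∀ k → v k ≢ v i → 0ℚ < depth k
  0<depth k vₖ≢vᵢ = <⇒0<- (exposes⇒< i k vₖ≢vᵢ)

  depth*section : ∀ k → v k ≢ v i → ∀ c → depth k * (c · section k) ≡ c · v k - c · v i
  depth*section k vₖ≢vᵢ c =
    trans (cong (depth k *_) (·-value c (ι ⊡ (⟨ v k ⟩ ⊟ ⟨ v i ⟩))))
      (trans (lemma (depth k) ι (c · v k - c · v i))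
        (trans (cong (_* (c · v k - c · v i)) (proj₂ (proj₂ (inverse (depth k)) (0<depth k vₖ≢vᵢ))))
          (*-identityˡ (c · v k - c · v i))))
    where
    ι = proj₁ (inverse (depth k))
    lemma : ∀ l ι x → l * (ι * x) ≡ ι * l * x
    lemma = solve-∀ ℚring

  a·section : ∀ k → v k ≢ v i → a · section k ≡ - 1ℚ
  a·section k vₖ≢vᵢ =
    trans (·-value a (ι ⊡ (⟨ v k ⟩ ⊟ ⟨ v i ⟩)))
      (trans (lemma ι (a · v i) (a · v k)) (cong -_ (proj₂ (proj₂ (inverse (depth k)) (0<depth k vₖ≢vᵢ)))))
    where
    ι = proj₁ (inverse (depth k))
    lemma : ∀ ι x y → ι * (y - x) ≡ - (ι * (x - y))
    lemma = solve-∀ ℚring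

  -- Both points lie on one ray from v i. The functional exposing v k increases along this ray and
  -- is larger at v k than at v j. Exchanging the roles of j and k then rules out two generators on
  -- one ray.
  farther : ∀ j k → v j ≢ v i → v k ≢ v i → v j ≢ v k → section k ≡ section j → depth j < depth k
  farther j k vⱼ≢vᵢ vₖ≢vᵢ vⱼ≢vₖ sₖ≡sⱼ = 0<-⇒< (0<*-cancelˡ {X} (<⇒≤ 0<X) (subst (0ℚ <_) eq (<⇒0<- (exposes⇒< k j vⱼ≢vₖ))))
    where
    α = proj₁ (exposed k)
    X = α · section k
    0<X : 0ℚ < X
    0<X = 0<*-cancelˡ {depth k} (<⇒≤ (0<depth k vₖ≢vᵢ))
      (subst (0ℚ <_) (sym (depth*section k vₖ≢vᵢ α)) (<⇒0<- (exposes⇒< k i (vₖ≢vᵢ ∘ sym))))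
    lemma : ∀ x y z → x - y ≡ x - z - (y - z)
    lemma = solve-∀ ℚring
    factor : ∀ p q x → p * x - q * x ≡ x * (p - q)
    factor = solve-∀ ℚring
    eq : α · v k - α · v j ≡ X * (depth k - depth j)
    eq = trans (lemma (α · v k) (α · v j) (α · v i))
      (trans (cong₂ _-_ (sym (depth*section k vₖ≢vᵢ α))
                (trans (sym (depth*section j vⱼ≢vᵢ α)) (cong (λ s → depth j * (α · s)) (sym sₖ≡sⱼ))))
        (factor (depth k) (depth j) X))

  section-injective : ∀ j k → v j ≢ v i → v k ≢ v i → section k ≡ section j → v k ≡ v j
  section-injective j k vⱼ≢vᵢ vₖ≢vᵢ eq = case v k ≟ₚ v j of λ where
    (yes vₖ≡vⱼ) → vₖ≡vⱼ
    (no vₖ≢vⱼ) → contradiction (farther j k vⱼ≢vᵢ vₖ≢vᵢ (vₖ≢vⱼ ∘ sym) eq)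
                   (<-asym (farther k j vₖ≢vᵢ vⱼ≢vᵢ vₖ≢vⱼ (sym eq)))

  -- The direction of v k makes c positive somewhere on the section, so c is positive at a maximiser
  -- too. `expose` picks a maximiser that is an extreme point, hence the direction of an edge.
  improving-edge : ∀ c k → c · v i < c · v k → ∃ λ j → ∃ λ b → Edge V i j b × c · v i < c · v j
  improving-edge c k c< =
    let j , c′ , vⱼ≢vᵢ , max , ex = expose {D = λ k → v k ≢ v i} (λ k → ≢-dec (v k ≟ₚ v i)) section c (k , vₖ≢vᵢ)
    in j , ⟦ supporting c′ j ⟧ , record
         { distinct = vⱼ≢vᵢ ∘ sym
         ; level = sym (level c′ j vⱼ≢vᵢ)
         ; below = λ l → case v l ≟ₚ v i of λ where
             (yes vₗ≡vᵢ) → inj₁ (inj₁ vₗ≡vᵢ)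
             (no vₗ≢vᵢ)  → [ (λ eq → inj₁ (inj₂ (section-injective j l vⱼ≢vᵢ vₗ≢vᵢ eq))) ,
                             (λ c′< → inj₂ (strict c′ j l vₗ≢vᵢ c′<)) ]′ (ex l vₗ≢vᵢ)
         } , improves j vⱼ≢vᵢ (max k vₖ≢vᵢ)
    where
    ≢-dec : ∀ {x y : Point d} → Dec (x ≡ y) → Dec (x ≢ y)
    ≢-dec (yes eq)  = no λ neq → neq eq
    ≢-dec (no neq) = yes neq

    vₖ≢vᵢ : v k ≢ v i
    vₖ≢vᵢ eq = <⇒≢ c< (cong (c ·_) (sym eq))

    supporting : Point d → Fin n → Expr d
    -- Since a is -1 on the section, adding this multiple of a shifts c′ to the value 0 at
    -- `section j` and to negative values at the other points of the section.
    supporting c′ j = (c′ · section j) ⊡ ⟨ a ⟩ ⊞ ⟨ c′ ⟩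

    supporting·section : ∀ c′ j l → v l ≢ v i → ⟦ supporting c′ j ⟧ · section l ≡ c′ · section l - c′ · section j
    supporting·section c′ j l vₗ≢vᵢ = trans (·-valueˡ (supporting c′ j) (section l))
      (trans (cong (λ z → c′ · section j * z + c′ · section l) (a·section l vₗ≢vᵢ)) (lemma (c′ · section j) (c′ · section l)))
      where
      lemma : ∀ x y → x * - 1ℚ + y ≡ y - x
      lemma = solve-∀ ℚring

    level : ∀ c′ j → v j ≢ v i → ⟦ supporting c′ j ⟧ · v j ≡ ⟦ supporting c′ j ⟧ · v i
    level c′ j vⱼ≢vᵢ = let b = ⟦ supporting c′ j ⟧ in
      trans (sym (-+-cancel (b · v i) (b · v j)))
        (trans (cong (_+ b · v i) (trans (sym (depth*section j vⱼ≢vᵢ b))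
            (trans (cong (depth j *_) (trans (supporting·section c′ j j vⱼ≢vᵢ) (+-inverseʳ (c′ · section j))))
              (*-zeroʳ (depth j)))))
          (+-identityˡ (b · v i)))

    strict : ∀ c′ j l → v l ≢ v i → c′ · section l < c′ · section j →
             ⟦ supporting c′ j ⟧ · v l < ⟦ supporting c′ j ⟧ · v i
    strict c′ j l vₗ≢vᵢ c′< = <-from (0<* (0<depth l vₗ≢vᵢ) (<⇒0<- c′<))
      (trans (lemma (depth l) (c′ · section j) (c′ · section l))
        (trans (cong (λ z → - (depth l * z)) (sym (supporting·section c′ j l vₗ≢vᵢ)))
          (trans (cong -_ (depth*section l vₗ≢vᵢ b)) (negate (b · v l) (b · v i)))))
      where
      b = ⟦ supporting c′ j ⟧
      lemma : ∀ l x y → l * (x - y) ≡ - (l * (y - x))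
      lemma = solve-∀ ℚring
      negate : ∀ x y → - (x - y) ≡ y - x
      negate = solve-∀ ℚring

    improves : ∀ j → v j ≢ v i → c · section k ≤ c · section j → c · v i < c · v j
    improves j vⱼ≢vᵢ c≤ = <-from
      (0<* (0<depth j vⱼ≢vᵢ) (<-≤-trans
        (0<*-cancelˡ {depth k} (<⇒≤ (0<depth k vₖ≢vᵢ)) (subst (0ℚ <_) (sym (depth*section k vₖ≢vᵢ c)) (<⇒0<- c<)))
        c≤))
      (depth*section j vⱼ≢vᵢ c)

-- Comparing edges of P and Q

-- The test functional is z = (e·e) u - (u·e) e, a multiple of the component of u orthogonal to e.
-- Since z·z = (e·e) (z·u) ≤ 0, it vanishes.
parallel : {e u : Point d} → e ≢ origin → (∀ z → z · e ≡ 0ℚ → z · u ≤ 0ℚ) → ∃ λ s → u ≡ scale s e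
parallel {e = e} {u} e≢0 h =
  let ι , 0<ι , ι*ee≡1 = reciprocal (x≢0⇒0<x·x e≢0) in ι * (u · e) , solve-for-u ι ι*ee≡1
  where
  z = (e · e) ⊡ ⟨ u ⟩ ⊟ (u · e) ⊡ ⟨ e ⟩

  z·e≡0 : ⟦ z ⟧ · e ≡ 0ℚ
  z·e≡0 = trans (·-valueˡ z e) (lemma (e · e) (u · e))
    where
    lemma : ∀ a b → a * b - b * a ≡ 0ℚ
    lemma = solve-∀ ℚring

  z·z≤0 : ⟦ z ⟧ · ⟦ z ⟧ ≤ 0ℚ
  z·z≤0 = subst (_≤ 0ℚ)
    (sym (trans (·-value ⟦ z ⟧ z) (trans (cong (λ y → e · e * (⟦ z ⟧ · u) - u · e * y) z·e≡0)
      (lemma (e · e * (⟦ z ⟧ · u)) (u · e)))))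
    (subst (e · e * (⟦ z ⟧ · u) ≤_) (*-zeroʳ (e · e))
      (*-monoˡ-≤-nonNeg (e · e) {{nonNegative (0≤x·x e)}} (h ⟦ z ⟧ z·e≡0)))
    where
    lemma : ∀ a b → a - b * 0ℚ ≡ a
    lemma = solve-∀ ℚring

  ee*u≡ue*e : scale (e · e) u ≡ scale (u · e) e
  ee*u≡ue*e = ⊖≡origin⇒≡ (x·x≡0⇒x≡0 (≤-antisym z·z≤0 (0≤x·x ⟦ z ⟧)))

  solve-for-u : ∀ ι → ι * (e · e) ≡ 1ℚ → u ≡ scale (ι * (u · e)) e
  solve-for-u ι ι*ee≡1 =
    trans (sym (scale-1 u)) (trans (cong (λ k → scale k u) (sym ι*ee≡1))
      (trans (assoc ι (e · e) u) (trans (cong (scale ι) ee*u≡ue*e) (sym (assoc ι (u · e) e)))))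
    where
    assoc : ∀ k l x → scale (k * l) x ≡ scale k (scale l x)
    assoc k l x = point-≡ ((k * l) ⊡ ⟨ x ⟩) (k ⊡ (l ⊡ ⟨ x ⟩)) λ i → *-assoc k l (lookup x i)

⊖≡⇒≡⊕ : {x y z : Point d} → x ⊖ y ≡ z → x ≡ y ⊕ z
⊖≡⇒≡⊕ {x = x} {y} refl = point-≡ ⟨ x ⟩ (⟨ y ⟩ ⊞ (⟨ x ⟩ ⊟ ⟨ y ⟩)) λ i → lemma (lookup x i) (lookup y i)
  where
  lemma : ∀ x y → x ≡ y + (x - y)
  lemma = solve-∀ ℚring

between : ∀ (p e : Point d) {s t} → 0ℚ ≤ s → s ≤ t → 0ℚ < t → Conv (p ∷ (p ⊕ scale t e) ∷ []) (p ⊕ scale s e)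
between p e {s} {t} 0≤s s≤t 0<t = let ι , 0<ι , ι*t≡1 = reciprocal 0<t in divide ι (<⇒≤ 0<ι) ι*t≡1
  where
  weights : ∀ ι s t → ι * (t - s) + ι * s ≡ ι * t
  weights = solve-∀ ℚring
  combine : ∀ ι s t p e → ι * (t - s) * p + ι * s * (p + t * e) ≡ ι * t * (p + s * e)
  combine = solve-∀ ℚring
  divide : ∀ ι → 0ℚ ≤ ι → ι * t ≡ 1ℚ → Conv (p ∷ (p ⊕ scale t e) ∷ []) (p ⊕ scale s e)
  divide ι 0≤ι ι*t≡1 = subst (Conv (p ∷ (p ⊕ scale t e) ∷ []))
    (point-≡ ((ι * (t - s)) ⊡ ⟨ p ⟩ ⊞ (ι * s) ⊡ (⟨ p ⟩ ⊞ t ⊡ ⟨ e ⟩)) (⟨ p ⟩ ⊞ s ⊡ ⟨ e ⟩) λ i →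
      trans (combine ι s t (lookup p i) (lookup e i))
        (trans (cong (_* (lookup p i + s * lookup e i)) ι*t≡1) (*-identityˡ (lookup p i + s * lookup e i))))
    (comb-pair (ι * (t - s)) (ι * s) (0≤* 0≤ι (≤⇒0≤- s≤t)) (0≤* 0≤ι 0≤s) (trans (weights ι s t) ι*t≡1))

module _ (V : Vec (Point d) n) (exposed : ∀ j → ∃ λ a → Exposes V a (lookup V j))
         (Q : Region d) (q : Fin n → Point d) (q∈Q : ∀ i → Q (q i))
         (q-max : ∀ i c → (∀ k → c · lookup V k ≤ c · lookup V i) → ∀ y → Q y → c · y ≤ c · q i) where
  private
    v : Fin n → Point d
    v = lookup V

  module _ {i j b} (E : Edge V i j b) where
    open Edge E

    -- The functional b is relatively interior to the normal cone of the edge, so a functional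
    -- constant along the edge enters that cone after adding enough of b.
    edge-normal : ∀ z → z · v i ≡ z · v j → ∃ λ N → ∀ k → (scale N b ⊕ z) · v k ≤ (scale N b ⊕ z) · v i
    edge-normal z z-level =
      let N , _ , dom = dominate (λ k → b · v k - b · v i) (λ k → z · v k - z · v i)
      in N , λ k → [ [ (λ eq → ≤-reflexive (cong ((scale N b ⊕ z) ·_) eq)) ,
                       (λ eq → ≤-reflexive (trans (cong ((scale N b ⊕ z) ·_) eq) (sym (both-level N)))) ]′ ,
                     (λ b< → strict N k (dom k (<-from (<⇒0<- b<) (negate (b · v i) (b · v k))))) ]′ (below k)
      where
      negate : ∀ x y → x - y ≡ 0ℚ - (y - x)
      negate = solve-∀ ℚring
      both-level : ∀ N → (scale N b ⊕ z) · v i ≡ (scale N b ⊕ z) · v j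
      both-level N = trans (·-valueˡ (N ⊡ ⟨ b ⟩ ⊞ ⟨ z ⟩) (v i))
        (trans (cong₂ (λ x y → N * x + y) level z-level) (sym (·-valueˡ (N ⊡ ⟨ b ⟩ ⊞ ⟨ z ⟩) (v j))))
      lemma : ∀ N x y s t → 0ℚ - (N * (x - y) + (s - t)) ≡ N * y + t - (N * x + s)
      lemma = solve-∀ ℚring
      strict : ∀ N k → N * (b · v k - b · v i) + (z · v k - z · v i) < 0ℚ → (scale N b ⊕ z) · v k ≤ (scale N b ⊕ z) · v i
      strict N k h = <⇒≤ (<-from (<⇒0<- h) (trans (lemma N (b · v k) (b · v i) (z · v k) (z · v i))
        (sym (cong₂ _-_ (·-valueˡ (N ⊡ ⟨ b ⟩ ⊞ ⟨ z ⟩) (v i)) (·-valueˡ (N ⊡ ⟨ b ⟩ ⊞ ⟨ z ⟩) (v k))))))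

    exposes-drop : 0ℚ < proj₁ (exposed i) · v i - proj₁ (exposed i) · v j
    exposes-drop = <⇒0<- ([ (λ eq → contradiction (sym eq) distinct) , id ]′ (proj₂ (exposed i) j))

    -- On the face of Q where b is maximal, `edge-normal` bounds z·(y - q i) by 0 for every z
    -- orthogonal to the edge, which gives parallelism. The sign of s is read off from the
    -- functional exposing v i, which decreases towards v j.
    on-ray : ∀ {y} → Q y → b · y ≡ b · q i → ∃ λ s → 0ℚ ≤ s × y ≡ q i ⊕ scale s (v j ⊖ v i)
    on-ray {y} y∈Q b·y≡b·q =
      let s , eq = parallel (distinct ∘ sym ∘ ⊖≡origin⇒≡) perpendicular in s , 0≤s s eq , ⊖≡⇒≡⊕ eq
      where
      perpendicular : ∀ z → z · (v j ⊖ v i) ≡ 0ℚ → z · (y ⊖ q i) ≤ 0ℚ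
      perpendicular z z⊥e =
        let N , normal = edge-normal z (level-from (trans (sym (·-value z (⟨ v j ⟩ ⊟ ⟨ v i ⟩))) z⊥e))
        in ≤-from (≤⇒0≤- (q-max i (scale N b ⊕ z) normal y y∈Q))
             (trans (cong₂ _-_ (·-valueˡ (N ⊡ ⟨ b ⟩ ⊞ ⟨ z ⟩) (q i)) (·-valueˡ (N ⊡ ⟨ b ⟩ ⊞ ⟨ z ⟩) y))
               (trans (cong (λ p → N * (b · q i) + z · q i - (N * p + z · y)) b·y≡b·q)
                 (trans (lemma N (b · q i) (z · q i) (z · y)) (cong (λ p → 0ℚ - p) (sym (·-value z (⟨ y ⟩ ⊟ ⟨ q i ⟩)))))))
        where
        level-from : z · v j - z · v i ≡ 0ℚ → z · v i ≡ z · v j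
        level-from eq = trans (sym (+-identityˡ (z · v i))) (trans (cong (_+ z · v i) (sym eq)) (-+-cancel (z · v i) (z · v j)))
        lemma : ∀ N p x y → N * p + x - (N * p + y) ≡ 0ℚ - (y - x)
        lemma = solve-∀ ℚring

      α = proj₁ (exposed i)

      0≤s : ∀ s → y ⊖ q i ≡ scale s (v j ⊖ v i) → 0ℚ ≤ s
      0≤s s eq = 0≤*-cancelˡ exposes-drop (subst (0ℚ ≤_)
        (trans (negate (α · q i) (α · y)) (trans (cong -_ (trans (sym (·-value α (⟨ y ⟩ ⊟ ⟨ q i ⟩)))
          (trans (cong (α ·_) eq) (·-value α (s ⊡ (⟨ v j ⟩ ⊟ ⟨ v i ⟩)))))) (lemma s (α · v i) (α · v j))))
        (≤⇒0≤- (q-max i α (exposes⇒≤ V α (proj₂ (exposed i))) y y∈Q)))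
        where
        negate : ∀ x y → x - y ≡ - (y - x)
        negate = solve-∀ ℚring
        lemma : ∀ s x y → - (s * (y - x)) ≡ (x - y) * s
        lemma = solve-∀ ℚring

  module _ {i j b} (E : Edge V i j b) where
    open Edge E

    b·q-level : b · q i ≡ b · q j
    b·q-level = ≤-antisym (q-max j b (Edge.bounded (reverse E)) (q i) (q∈Q i)) (q-max i b bounded (q j) (q∈Q j))

    -- By `on-ray` at both ends, the face of Q where b is maximal lies on a ray leaving q i towards
    -- q j and on the opposite ray leaving q j. For t > 0 the two rays meet in the segment.
    edge-image : ∃ λ t → 0ℚ ≤ t × q j ≡ q i ⊕ scale t (v j ⊖ v i) ×
                 (0ℚ < t → ∀ y → Q y → b · y ≡ b · q i → Conv (q i ∷ q j ∷ []) y)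
    edge-image =
      let t , 0≤t , q≡ = on-ray E (q∈Q j) (sym b·q-level)
      in t , 0≤t , q≡ , λ 0<t y y∈Q b·y≡ →
           let s , 0≤s , y≡ = on-ray E y∈Q b·y≡
               s′ , 0≤s′ , y≡′ = on-ray (reverse E) y∈Q (trans b·y≡ b·q-level)
           in subst₂ (λ qⱼ y → Conv (q i ∷ qⱼ ∷ []) y) (sym q≡) (sym y≡)
                (between (q i) (v j ⊖ v i) 0≤s (s≤t q≡ y≡ y≡′ 0≤s′) 0<t)
      where
      s≤t : ∀ {y t s s′} → q j ≡ q i ⊕ scale t (v j ⊖ v i) → y ≡ q i ⊕ scale s (v j ⊖ v i) →
            y ≡ q j ⊕ scale s′ (v i ⊖ v j) → 0ℚ ≤ s′ → s ≤ t
      s≤t {y} {t} {s} {s′} q≡ y≡ y≡′ 0≤s′ = 0≤-⇒≤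
        (0≤*-cancelˡ {δ} (exposes-drop E) (subst (0ℚ ≤_) eq (0≤* 0≤s′ (<⇒≤ (exposes-drop E)))))
        where
        α = proj₁ (exposed i)
        δ = α · v i - α · v j
        ray : ∀ (x f g p : Point d) r → x ≡ p ⊕ scale r (f ⊖ g) → α · x ≡ α · p + r * (α · f - α · g)
        ray x f g p r eq = trans (cong (α ·_) eq) (·-value α (⟨ p ⟩ ⊞ r ⊡ (⟨ f ⟩ ⊟ ⟨ g ⟩)))
        isolate : ∀ a b c → a ≡ b + c → c ≡ a - b
        isolate .(b + c) b c refl = lemma b c
          where
          lemma : ∀ b c → c ≡ b + c - b
          lemma = solve-∀ ℚring
        lemma : ∀ p s t x y → p + s * (y - x) - (p + t * (y - x)) ≡ (x - y) * (t - s)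
        lemma = solve-∀ ℚring
        eq : s′ * δ ≡ δ * (t - s)
        eq = trans (isolate (α · y) (α · q j) (s′ * δ) (ray y (v i) (v j) (q j) s′ y≡′))
          (trans (cong₂ _-_ (ray y (v j) (v i) (q i) s y≡) (ray (q j) (v j) (v i) (q i) t q≡))
            (lemma (α · q i) s t (α · v i) (α · v j)))

-- Shephard's criterion: dQ as a Minkowski summand of P

module Summand {d n m : ℕ} (VQ : Vec (Point d) n) (VP : Vec (Point d) m)
  (refines : Refines (Conv VP) (Conv VQ))
  (long-edges : ∀ (eP : Region d) (vP wP : Point d) → IsEdge (Conv VP) eP vP wP →
    ∀ (eQ : Region d) → IsΦ (Conv VP) (Conv VQ) eP eQ →
    ∀ (vQ wQ : Point d) → IsEdge (Conv VQ) eQ vQ wQ →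
    ∀ (kP kQ : ℚ) → LatticeMultiple (wP ⊖ vP) kP →
    LatticeMultiple (wQ ⊖ vQ) kQ →
    ℕtoℚ d * ∣ kQ ∣ ≤ ∣ kP ∣)
  {ℓ : ℕ} (W : Vec (Point d) ℓ) (P⊆W : Conv VP ⊆ Conv W)
  (W⊆VP : ∀ j → (∃ λ i → lookup VP i ≡ lookup W j) × ∃ λ a → Exposes VP a (lookup W j)) where

  private
    P Q : Region d
    P = Conv VP
    Q = Conv VQ

    D : ℚ
    D = ℕtoℚ d

    0≤D : 0ℚ ≤ D
    0≤D = ℕtoℚ-mono-≤ (z≤n {d})

    p : Fin ℓ → Point d
    p = lookup W

    p∈P : ∀ j → P (p j)
    p∈P j = let (i , eq) , _ = W⊆VP j in subst P eq (comb-lookup VP i)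

    W⊆P : ∀ {t x} → Comb W t x → Comb VP t x
    W⊆P = comb-bind p∈P

    exposed : ∀ j → ∃ λ a → Exposes W a (p j)
    exposed j = let _ , a , ex = W⊆VP j in a , λ k →
      let (i , eq) , _ = W⊆VP k in subst (λ u → u ≡ p j ⊎ a · u < a · p j) eq (ex i)

    -- Refinement yields a face of Q. Any point g of it serves as q(p j): a functional maximal at p
    -- j is maximal on the whole face.
    vertex-image : ∀ j → ∃ λ g → Q g × (∀ c → (∀ k → c · p k ≤ c · p j) → ∀ y → Q y → c · y ≤ c · g)
    vertex-image j =
      let _ , a , ex = W⊆VP j
          G , ((g , g∈G) , _ , face) , cone⊆ = refines (λ x → x ≡ p j) (exposes⇒vertex VP a (p∈P j) ex)
      in g , proj₁ (Equivalence.to (face g) g∈G) , λ c max →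
           proj₂ (cone⊆ c (λ { x refl → p∈P j , λ y y∈P → conv-≤ c max (P⊆W y y∈P) }) g g∈G)

    q : Fin ℓ → Point d
    q j = proj₁ (vertex-image j)

    q∈Q : ∀ j → Q (q j)
    q∈Q j = proj₁ (proj₂ (vertex-image j))

    q-max : ∀ j c → (∀ k → c · p k ≤ c · p j) → ∀ y → Q y → c · y ≤ c · q j
    q-max j = proj₂ (proj₂ (vertex-image j))

  module _ {i j b} (E : Edge W i j b) where
    open Edge E

    private
      segmentP segmentQ : Region d
      segmentP = Conv (p i ∷ p j ∷ [])
      segmentQ = Conv (q i ∷ q j ∷ [])

      b-max : ∀ y → Q y → b · y ≤ b · q i
      b-max = q-max i b bounded

      faceP : IsFace P segmentP
      faceP = segment-face VP b (p∈P i) (p∈P j) level (λ y y∈P → conv-≤ b bounded (P⊆W y y∈P))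
        λ y y∈P → conv-face b (λ k →
          [ [ (λ eq → inj₁ (cong (b ·_) eq , subst segmentP (sym eq) (comb-lookup (p i ∷ p j ∷ []) zero))) ,
              (λ eq → inj₁ (trans (cong (b ·_) eq) (sym level) ,
                            subst segmentP (sym eq) (comb-lookup (p i ∷ p j ∷ []) (suc zero)))) ]′ ,
            inj₂ ]′ (below k)) (P⊆W y y∈P)

      module _ (onto : ∀ y → Q y → b · y ≡ b · q i → segmentQ y) where

        faceQ : IsFace Q segmentQ
        faceQ = segment-face VQ b (q∈Q i) (q∈Q j) (b·q-level W exposed Q q q∈Q q-max E) b-max onto

        -- Minimality is tested on b alone: if the normal cone of G′ contains that of the edge of P,
        -- then b is maximal on G′, so G′ lies in `segmentQ` and its normal cone is at least as
        -- large.
        isΦ : IsΦ P Q segmentP segmentQ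
        isΦ = faceQ ,
          (λ c normal x x∈ → comb-bind (λ { zero → q∈Q i ; (suc zero) → q∈Q j }) x∈ , λ y y∈Q →
             conv-≥ c (λ { zero → q-max i c (λ k → proj₂ (normal (p i) (comb-lookup (p i ∷ p j ∷ []) zero)) (p k) (p∈P k)) y y∈Q
                         ; (suc zero) → q-max j c
                             (λ k → proj₂ (normal (p j) (comb-lookup (p i ∷ p j ∷ []) (suc zero))) (p k) (p∈P k)) y y∈Q }) x∈) ,
          λ G′ _ cone⊆ c normal x x∈G′ → normal x
            (let x∈Q , x-max = cone⊆ b b-normal x x∈G′ in onto x x∈Q (≤-antisym (b-max x x∈Q) (x-max (q i) (q∈Q i))))
          where
          b-normal : NormalCone P segmentP b
          b-normal x x∈ = comb-bind (λ { zero → p∈P i ; (suc zero) → p∈P j }) x∈ , λ y y∈P →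
            conv-≥ b (λ { zero → conv-≤ b bounded (P⊆W y y∈P)
                        ; (suc zero) → subst (b · y ≤_) level (conv-≤ b bounded (P⊆W y y∈P)) }) x∈

        -- If p j - p i = k u with u primitive, then q j - q i = (t k) u with the same u. The length
        -- hypothesis becomes D |t k| ≤ |k|, and |k| cancels.
        compare : ∀ {t} → 0ℚ < t → q j ≡ q i ⊕ scale t (p j ⊖ p i) → D * t ≤ 1ℚ
        compare {t} 0<t q≡ = [ (λ eq → contradiction (sym (⊖≡origin⇒≡ eq)) distinct) , bound ]′
                               (primitive-multiple (p j ⊖ p i))
          where
          q-difference : ∀ {e k x} → x ≡ scale k e → q j ≡ q i ⊕ scale t x → q j ⊖ q i ≡ scale (t * k) e
          q-difference {e} {k} refl eq = trans (cong (_⊖ q i) eq)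
            (point-≡ (⟨ q i ⟩ ⊞ t ⊡ (k ⊡ ⟨ e ⟩) ⊟ ⟨ q i ⟩) ((t * k) ⊡ ⟨ e ⟩)
              λ l → lemma (lookup (q i) l) t k (lookup e l))
            where
            lemma : ∀ q t k x → q + t * (k * x) - q ≡ t * k * x
            lemma = solve-∀ ℚring

          qᵢ≢qⱼ : q i ≢ q j
          qᵢ≢qⱼ eq = scale≢origin (<⇒≢ 0<t ∘ sym) (distinct ∘ sym ∘ ⊖≡origin⇒≡)
            (trans (point-≡ ⟨ scale t (p j ⊖ p i) ⟩ (⟨ q i ⟩ ⊞ ⟨ scale t (p j ⊖ p i) ⟩ ⊟ ⟨ q i ⟩)
                      λ l → lemma (lookup (q i) l) (lookup (scale t (p j ⊖ p i)) l))
              (trans (cong (_⊖ q i) (trans (sym q≡) (sym eq)))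
                (point-≡ (⟨ q i ⟩ ⊟ ⟨ q i ⟩) 𝟎 λ l → +-inverseʳ (lookup (q i) l))))
            where
            lemma : ∀ q x → x ≡ q + x - q
            lemma = solve-∀ ℚring

          bound : (∃ λ k → k ≢ 0ℚ × LatticeMultiple (p j ⊖ p i) k) → D * t ≤ 1ℚ
          bound (k , k≢0 , u , u-prim , eq) = 0≤-⇒≤ (0≤*-cancelˡ 0<∣k∣ (subst (0ℚ ≤_) factor (≤⇒0≤- long)))
            where
            0<∣k∣ : 0ℚ < ∣ k ∣
            0<∣k∣ = ≰⇒> λ ∣k∣≤0 → k≢0 (∣p∣≡0⇒p≡0 k (≤-antisym ∣k∣≤0 (0≤∣p∣ k)))
            long : D * ∣ t * k ∣ ≤ ∣ k ∣
            long = long-edges segmentP (p i) (p j) (faceP , distinct , λ x → mk⇔ id id)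
                     segmentQ isΦ (q i) (q j) (faceQ , qᵢ≢qⱼ , λ x → mk⇔ id id)
                     k (t * k) (u , u-prim , eq) (u , u-prim , q-difference eq q≡)
            lemma : ∀ D t k → k - D * (t * k) ≡ k * (1ℚ - D * t)
            lemma = solve-∀ ℚring
            factor : ∣ k ∣ - D * ∣ t * k ∣ ≡ ∣ k ∣ * (1ℚ - D * t)
            factor = trans (cong (λ z → ∣ k ∣ - D * z) (trans (∣p*q∣≡∣p∣*∣q∣ t k) (cong (_* ∣ k ∣) (0≤p⇒∣p∣≡p (<⇒≤ 0<t)))))
                       (lemma D t ∣ k ∣)

    edge-ratio : ∃ λ t → 0ℚ ≤ t × D * t ≤ 1ℚ × q j ≡ q i ⊕ scale t (p j ⊖ p i)
    edge-ratio =
      let t , 0≤t , q≡ , onto = edge-image W exposed Q q q∈Q q-max E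
      in t , 0≤t , short onto 0≤t q≡ , q≡
      where
      short : ∀ {t} → (0ℚ < t → ∀ y → Q y → b · y ≡ b · q i → segmentQ y) → 0ℚ ≤ t →
              q j ≡ q i ⊕ scale t (p j ⊖ p i) → D * t ≤ 1ℚ
      short {t} onto 0≤t q≡ = case 0ℚ <? t of λ where
        (yes 0<t) → compare (onto 0<t) 0<t q≡
        -- Here t = 0: the edge is collapsed to a point of Q and the length hypothesis does not
        -- apply, but D t = 0.
        (no 0≮t)  → subst (λ t → D * t ≤ 1ℚ) (≤-antisym 0≤t (≮⇒≥ 0≮t)) (subst (_≤ 1ℚ) (sym (*-zeroʳ D)) 0≤1)

  r : Fin ℓ → Point d
  r j = p j ⊖ scale D (q j)

  c·r : ∀ c j → c · r j ≡ c · p j - D * (c · q j)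
  c·r c j = ·-value c (⟨ p j ⟩ ⊟ D ⊡ ⟨ q j ⟩)

  -- The increase of c·r is (1 - D t) times that of c·p. It is 0 when D t = 1, hence the weak
  -- inequality and the tie-break by c·p in `best-vertex`.
  ascent : ∀ c {i j b} → Edge W i j b → c · p i < c · p j → c · r i ≤ c · r j
  ascent c {i} {j} E c< =
    let t , 0≤t , Dt≤1 , q≡ = edge-ratio E
    in ≤-from (0≤* (≤⇒0≤- Dt≤1) (≤⇒0≤- (<⇒≤ c<)))
         (trans (lemma D t (c · p i) (c · p j) (c · q i))
           (sym (cong₂ _-_
             (trans (c·r c j) (cong (λ z → c · p j - D * z)
               (trans (cong (c ·_) q≡) (·-value c (⟨ q i ⟩ ⊞ t ⊡ (⟨ p j ⟩ ⊟ ⟨ p i ⟩))))))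
             (c·r c i))))
    where
    lemma : ∀ D t x y q → (1ℚ - D * t) * (y - x) ≡ y - D * (q + t * (y - x)) - (x - D * q)
    lemma = solve-∀ ℚring

  -- Lexicographically maximise (c·r, c·p): an improving edge would not decrease c·r, so the maximiser is c-maximal.
  best-vertex : Fin ℓ → ∀ c → ∃ λ j → (∀ k → c · r k ≤ c · r j) × (∀ k → c · p k ≤ c · p j)
  best-vertex i c =
    let j , _ , best = argmax {_≼_ = _≤ₗₑₓ_} ≤ₗₑₓ-total ≤ₗₑₓ-trans {D = λ _ → ⊤} (λ _ → yes tt) (λ k → c · r k , c · p k) (i , tt)
    in j , (λ k → ≤ₗₑₓ⇒≤ (best k tt)) , λ k → ≮⇒≥ λ c< →
         let j′ , b , E , c<′ = VertexFigure.improving-edge W exposed j c k c<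
         in not-best (ascent c E c<′) c<′ (best j′ tt)
    where
    not-best : ∀ {x y x′ y′} → x ≤ x′ → y < y′ → ¬ ((x′ , y′) ≤ₗₑₓ (x , y))
    not-best x≤x′ y<y′ (inj₁ x′<x)       = <-irrefl refl (<-≤-trans x′<x x≤x′)
    not-best x≤x′ y<y′ (inj₂ (_ , y′≤y)) = <-irrefl refl (<-≤-trans y<y′ y′≤y)

  -- At a j maximising both c·r and c·p, the bounds c·r i ≤ c·r j and c·y ≤ c·q j add up to c·p j,
  -- because p j = r j + D q j. No c can then separate the point from P.
  r+DQ⊆P : ∀ i {y} → Q y → P (r i ⊕ scale D y)
  r+DQ⊆P i {y} y∈Q = [ W⊆P , (λ (c , h) → ⊥-elim (absurd c h (best-vertex i c))) ]′ (separate W (r i ⊕ scale D y))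
    where
    absurd : ∀ c → (∀ j → c · p j < c · (r i ⊕ scale D y)) →
             ¬ ∃ λ j → (∀ k → c · r k ≤ c · r j) × (∀ k → c · p k ≤ c · p j)
    absurd c h (j , r-max , p-max) = <-irrefl refl (<-≤-trans (h j)
      (subst₂ _≤_ (sym (·-value c (⟨ r i ⟩ ⊞ D ⊡ ⟨ y ⟩)))
        (trans (cong (_+ D * (c · q j)) (c·r c j)) (-+-cancel (D * (c · q j)) (c · p j)))
        (+-mono-≤ (r-max i) (*-monoˡ-≤-nonNeg D {{nonNegative 0≤D}} (q-max j c p-max y y∈Q)))))

  -- The summand R appears only as the Minkowski difference: its points s are those with s + D g in
  -- P for all g in Q. Both parts are scaled by the weight t so that the induction on combinations
  -- goes through.
  P⊆DQ+R : ∀ {t x} → Comb W t x → ∃ λ y → ∃ λ s → x ≡ y ⊕ s × Comb VQ (D * t) y ×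
           (∀ {g} → Q g → Comb VP t (s ⊕ scale (D * t) g))
  P⊆DQ+R = comb-elim
    (λ t x → ∃ λ y → ∃ λ s → x ≡ y ⊕ s × Comb VQ (D * t) y × (∀ {g} → Q g → Comb VP t (s ⊕ scale (D * t) g)))
    (origin , origin , sym (⊕-identityˡ origin) , subst (λ t → Comb VQ t origin) (sym (*-zeroʳ D)) (comb-0 VQ) ,
      λ {g} _ → subst (Comb VP 0ℚ)
        (sym (trans (⊕-identityˡ _) (trans (cong (λ k → scale k g) (*-zeroʳ D)) (scale-0 g)))) (comb-0 VP))
    (λ { {t} {t′} (y , s , refl , y∈ , s∈) (y′ , s′ , refl , y′∈ , s′∈) → y ⊕ y′ , s ⊕ s′ ,
      point-≡ ((⟨ y ⟩ ⊞ ⟨ s ⟩) ⊞ (⟨ y′ ⟩ ⊞ ⟨ s′ ⟩)) ((⟨ y ⟩ ⊞ ⟨ y′ ⟩) ⊞ (⟨ s ⟩ ⊞ ⟨ s′ ⟩))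
        (λ i → interchange (lookup y i) (lookup s i) (lookup y′ i) (lookup s′ i)) ,
      subst (λ t → Comb VQ t (y ⊕ y′)) (sym (*-distribˡ-+ D t t′)) (comb-+ y∈ y′∈) ,
      λ {g} g∈Q → subst (Comb VP (t + t′))
        (point-≡ (⟨ s ⟩ ⊞ (D * t) ⊡ ⟨ g ⟩ ⊞ (⟨ s′ ⟩ ⊞ (D * t′) ⊡ ⟨ g ⟩)) (⟨ s ⟩ ⊞ ⟨ s′ ⟩ ⊞ (D * (t + t′)) ⊡ ⟨ g ⟩)
          λ i → plus D t t′ (lookup s i) (lookup s′ i) (lookup g i))
        (comb-+ (s∈ g∈Q) (s′∈ g∈Q)) })
    (λ { {t} k 0≤k (y , s , refl , y∈ , s∈) → scale k y , scale k s ,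
      point-≡ (k ⊡ (⟨ y ⟩ ⊞ ⟨ s ⟩)) (k ⊡ ⟨ y ⟩ ⊞ k ⊡ ⟨ s ⟩) (λ i → *-distribˡ-+ k (lookup y i) (lookup s i)) ,
      subst (λ t → Comb VQ t (scale k y)) (swap k D t) (comb-* k 0≤k y∈) ,
      λ {g} g∈Q → subst (Comb VP (k * t))
        (point-≡ (k ⊡ (⟨ s ⟩ ⊞ (D * t) ⊡ ⟨ g ⟩)) (k ⊡ ⟨ s ⟩ ⊞ (D * (k * t)) ⊡ ⟨ g ⟩)
          λ i → times D k t (lookup s i) (lookup g i))
        (comb-* k 0≤k (s∈ g∈Q)) })
    λ i → scale D (q i) , r i ,
      point-≡ ⟨ p i ⟩ (D ⊡ ⟨ q i ⟩ ⊞ (⟨ p i ⟩ ⊟ D ⊡ ⟨ q i ⟩)) (λ j → add-back (lookup (p i) j) (D * lookup (q i) j)) ,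
      comb-* D 0≤D (q∈Q i) ,
      λ {g} g∈Q → subst (λ k → P (r i ⊕ scale k g)) (sym (*-identityʳ D)) (r+DQ⊆P i g∈Q)
    where
    interchange : ∀ a b c d → a + b + (c + d) ≡ a + c + (b + d)
    interchange = solve-∀ ℚring
    plus : ∀ D t t′ s s′ g → s + D * t * g + (s′ + D * t′ * g) ≡ s + s′ + D * (t + t′) * g
    plus = solve-∀ ℚring
    swap : ∀ k D t → k * (D * t) ≡ D * (k * t)
    swap = solve-∀ ℚring
    times : ∀ D k t s g → k * (s + D * t * g) ≡ k * s + D * (k * t) * g
    times = solve-∀ ℚring
    add-back : ∀ x y → x ≡ y + (x - y)
    add-back = solve-∀ ℚring

-- Convex normality of the pair (Q, P)

dilation : ∀ (V : Vec (Point d) n) {x y} → Conv V x → Comb V (ℕtoℚ d) y → ∃ λ g → Conv V g × y ≡ scale (ℕtoℚ d) g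
-- In dimension 0 division by d is impossible; the given point of the hull is the witness, as all
-- points coincide.
dilation {zero} V {x} {[]} x∈V _ = x , x∈V , point-≡ ⟨ [] ⟩ (ℕtoℚ 0 ⊡ ⟨ x ⟩) λ ()
dilation {d@(suc d′)} V {y = y} _ y∈ =
  let ι , 0<ι , ι*d≡1 = reciprocal 0<d
  in scale ι y , subst (λ t → Comb V t (scale ι y)) ι*d≡1 (comb-* ι (<⇒≤ 0<ι) y∈) , undo ι ι*d≡1
  where
  0<d : 0ℚ < ℕtoℚ d
  0<d = positive⁻¹ (ℕtoℚ d) {{normalize-pos d 1}}
  undo : ∀ ι → ι * ℕtoℚ d ≡ 1ℚ → y ≡ scale (ℕtoℚ d) (scale ι y)
  undo ι ι*d≡1 = point-≡ ⟨ y ⟩ (ℕtoℚ d ⊡ (ι ⊡ ⟨ y ⟩)) λ i →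
    trans (sym (*-identityˡ (lookup y i))) (trans (cong (_* lookup y i) (sym ι*d≡1)) (swap ι (ℕtoℚ d) (lookup y i)))
    where
    swap : ∀ ι d y → ι * d * y ≡ d * (ι * y)
    swap = solve-∀ ℚring

lattice-origin : (v : Point d) → IsLatticePoint (v ⊖ v)
lattice-origin []      = []
lattice-origin (a ∷ v) = (int 0 , +-inverseʳ a) ∷ lattice-origin v

mainTheorem8 : (d n m : ℕ) (VQ : Vec (Point d) n) (VP : Vec (Point d) m) →
    FullDim (Conv VP) → FullDim (Conv VQ) →
    Refines (Conv VP) (Conv VQ) →
    (∀ (eP : Region d) (vP wP : Point d) → IsEdge (Conv VP) eP vP wP →
    ∀ (eQ : Region d) → IsΦ (Conv VP) (Conv VQ) eP eQ →
    ∀ (vQ wQ : Point d) → IsEdge (Conv VQ) eQ vQ wQ →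
    ∀ (kP kQ : ℚ) → LatticeMultiple (wP ⊖ vP) kP →
    LatticeMultiple (wQ ⊖ vQ) kQ →
    ℕtoℚ d * ∣ kQ ∣ ≤ ∣ kP ∣) →
    ∀ (x : Point d) →
    MinkSum (Conv VQ) (Conv VP) x ⇔ MinkSum (GSet (Conv VQ)) (Conv VP) x
mainTheorem8 d n m VQ VP _ _ refines long-edges x = mk⇔ only-G
  (λ (a , b , (a∈Q , _) , b∈P , eq) → a , b , a∈Q , b∈P , eq)
  where
  only-G : MinkSum (Conv VQ) (Conv VP) x → MinkSum (GSet (Conv VQ)) (Conv VP) x
  only-G (a , b , a∈Q , b∈P , x≡) =
    let _ , W , W⊆VP , P⊆W = exposed-generators VP
        y , s , b≡ , y∈ , s∈ = Summand.P⊆DQ+R VQ VP refines long-edges W P⊆W W⊆VP (P⊆W b b∈P)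
        _ , U , U⊆ , Q⊆U = exposed-generators VQ
        -- The point a + y has weight 1 + d over the vertices of Q: 1 from a and d from the dQ part
        -- of b.
        i , y′ , y′∈ , eq = extract-generator U
          (subst (λ t → Comb U t (a ⊕ y)) (weight (ℕtoℚ d))
            (comb-bind (λ k → Q⊆U (lookup VQ k) (comb-lookup VQ k)) (comb-+ a∈Q y∈)))
        _ , α , ex = U⊆ i
        u∈Q = λ i → let (k , eq) , _ = U⊆ i in subst (Conv VQ) eq (comb-lookup VQ k)
        g , g∈Q , y′≡ = dilation VQ a∈Q (comb-bind u∈Q y′∈)
        u = lookup U i
    -- The extracted vertex u lies in G(Q) with lattice vector u - u = 0. The remainder d g may
    -- replace y beside s, because s + d g lies in P for every g in Q.
    in u , s ⊕ scale (ℕtoℚ d * 1ℚ) g , (u∈Q i , u , exposes⇒vertex VQ α (u∈Q i) ex , lattice-origin u) , s∈ g∈Q ,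
       trans x≡ (trans (cong (a ⊕_) b≡) (trans (assoc a y s) (trans (cong (_⊕ s) (trans eq (cong (u ⊕_) y′≡)))
         (regroup u g s))))
    where
    weight : ∀ d → 1ℚ + d * 1ℚ ≡ d + 1ℚ
    weight = solve-∀ ℚring
    assoc : ∀ x y z → x ⊕ (y ⊕ z) ≡ (x ⊕ y) ⊕ z
    assoc x y z = point-≡ (⟨ x ⟩ ⊞ (⟨ y ⟩ ⊞ ⟨ z ⟩)) (⟨ x ⟩ ⊞ ⟨ y ⟩ ⊞ ⟨ z ⟩)
      λ i → sym (+-assoc (lookup x i) (lookup y i) (lookup z i))
    regroup : ∀ u g s → (u ⊕ scale (ℕtoℚ d) g) ⊕ s ≡ u ⊕ (s ⊕ scale (ℕtoℚ d * 1ℚ) g)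
    regroup u g s = point-≡ (⟨ u ⟩ ⊞ ℕtoℚ d ⊡ ⟨ g ⟩ ⊞ ⟨ s ⟩) (⟨ u ⟩ ⊞ (⟨ s ⟩ ⊞ (ℕtoℚ d * 1ℚ) ⊡ ⟨ g ⟩))
      λ i → lemma (lookup u i) (ℕtoℚ d) (lookup g i) (lookup s i)
      where
      lemma : ∀ u d g s → u + d * g + s ≡ u + (s + d * 1ℚ * g)
      lemma = solve-∀ ℚring
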